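{- Let $\alpha$ be a non-zero algebraic number, let $R$ be a complete residue system of $\mathbb{Z}[\alpha]/\alpha\mathbb{Z}[\alpha]$, and let $J$ be the associated map (see context). Then there is a positive integer $L=L(\alpha,R)$ such that for each $\beta\in\mathbb{Z}[\alpha]$ there is a constant $c=c(\alpha,\beta)\in\mathbb{N}$ for which $L\,J^{(n)}(\beta)$ is an algebraic integer for all $n\geq c$.
   Context: A complete residue system of $\mathbb{Z}[\alpha]/\alpha\mathbb{Z}[\alpha]$ is a subset $R\subset\mathbb{Z}[\alpha]$ containing exactly one element of each coset of $\alpha\mathbb{Z}[\alpha]$. The map $J:\mathbb{Z}[\alpha]\to\mathbb{Z}[\alpha]$ is $J(\beta)=(\beta-r)/\alpha$, where $r$ is the unique element of $R$ with $\beta-r\in\alpha\mathbb{Z}[\alpha]$; $J^{(n)}$ denotes the $n$-th iterate ($J^{(0)}=\mathrm{id}$). -}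

module Defs where

open import Data.Nat using (ℕ; zero; suc)
open import Data.Integer using (ℤ; 0ℤ; 1ℤ; -1ℤ; +_) renaming (_+_ to _+ℤ_; _*_ to _*ℤ_; -_ to -ℤ_)
open import Data.List using (List; []; _∷_; map; _++_)
open import Data.List.Relation.Unary.All using (All)
open import Data.Product using (Σ; ∃; _×_)
open import Data.Sum using (_⊎_)
open import Relation.Binary.PropositionalEquality using (_≡_)
open import Relation.Nullary using (¬_)

-- Polynomials in ℤ[x], as coefficient lists (lowest degree first).
-- Trailing zeros are allowed; equality of polynomials is ≈ₚ below.

Poly : Set
Poly = List ℤ

infixl 6 _+ₚ_ _-ₚ_
infixl 7 _*ₚ_ _·ₚ_

_+ₚ_ : Poly → Poly → Poly
[]       +ₚ q        = q
(a ∷ p)  +ₚ []       = a ∷ p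
(a ∷ p)  +ₚ (b ∷ q)  = (a +ℤ b) ∷ (p +ₚ q)

-ₚ_ : Poly → Poly
-ₚ p = map -ℤ_ p

_-ₚ_ : Poly → Poly → Poly
p -ₚ q = p +ₚ (-ₚ q)

_·ₚ_ : ℤ → Poly → Poly
a ·ₚ p = map (a *ℤ_) p

_*ₚ_ : Poly → Poly → Poly
[]      *ₚ q = []
(a ∷ p) *ₚ q = (a ·ₚ q) +ₚ (0ℤ ∷ (p *ₚ q))

X : Poly
X = 0ℤ ∷ 1ℤ ∷ []

const : ℤ → Poly
const c = c ∷ []

IsZeroₚ : Poly → Set
IsZeroₚ p = All (_≡ 0ℤ) p

_≈ₚ_ : Poly → Poly → Set
p ≈ₚ q = IsZeroₚ (p -ₚ q)

_∣ₚ_ : Poly → Poly → Set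
f ∣ₚ p = Σ Poly λ h → p ≈ₚ (h *ₚ f)

Unitₚ : Poly → Set
Unitₚ p = (p ≈ₚ const 1ℤ) ⊎ (p ≈ₚ const -1ℤ)

-- f is nonconstant and irreducible in ℤ[x] (hence primitive and, by Gauss,
-- irreducible over ℚ): f is, up to sign, the minimal polynomial over ℤ of
-- an algebraic number α.
IsMinimalPoly : Poly → Set
IsMinimalPoly f =
  (¬ Σ ℤ λ c → f ≈ₚ const c) ×
  (∀ g h → f ≈ₚ (g *ₚ h) → Unitₚ g ⊎ Unitₚ h)

-- ℤ[α] ≅ ℤ[x]/(f), where f is the minimal polynomial of α over ℤ.
-- Elements of ℤ[α] are represented by polynomials; α is represented by X.

_≡[_]_ : Poly → Poly → Poly → Set
p ≡[ f ] q = f ∣ₚ (p -ₚ q)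

InαIdeal : Poly → Poly → Set
InαIdeal f p = Σ Poly λ γ → p ≡[ f ] (X *ₚ γ)

evalAt : Poly → Poly → Poly
evalAt []      p = []
evalAt (a ∷ g) p = const a +ₚ (p *ₚ evalAt g p)

Monic : Poly → Set
Monic g = Σ Poly λ g' → g ≡ g' ++ (1ℤ ∷ [])

IsAlgInt : Poly → Poly → Set
IsAlgInt f p = Σ Poly λ g → Monic g × (evalAt g p ≡[ f ] [])

IsCompleteResidueSystem : Poly → (Poly → Set) → Set
IsCompleteResidueSystem f R =
  (∀ β → Σ Poly λ r → R r × InαIdeal f (β -ₚ r)) ×
  (∀ r r' → R r → R r' → InαIdeal f (r -ₚ r') → r ≡[ f ] r')

IsJMap : Poly → (Poly → Set) → (Poly → Poly) → Set
IsJMap f R J = ∀ β → Σ Poly λ r → R r × (β ≡[ f ] (r +ₚ (X *ₚ J β)))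

iter : {A : Set} → (A → A) → ℕ → A → A
iter g zero    a = a
iter g (suc n) a = g (iter g n a)

module Submission where

-- Let α ≠ 0 have minimal polynomial f = a xᵈ⁺¹ + f'(x) ∈ ℤ[x], so that
-- ℤ[α] = ℤ[x]/(f), and let J(β) = (β − r)/α for the r ∈ R with β ≡ r (mod α).
--
-- Proof.  (1) Since f(0) = a₀ ≠ 0, α is not a zero divisor, and β ∈ αℤ[α]
-- iff a₀ ∣ β(0); hence R meets only |a₀| classes and its elements have
-- representatives of bounded length D.  Dividing by α lowers the length of
-- a representative by one as long as it exceeds E = max(D, length f), so
-- for n ≥ length β the iterate Jⁿ(β) is represented by a polynomial q of
-- degree < E.  (2) Put c = |a| and γ = cα; then γ is a root of a monic
-- integer polynomial, and cᴱ q(α) = q̃(γ) ∈ ℤ[γ] for the rescaled q̃.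
-- (3) ℤ[γ] is spanned by 1, γ, …, γᵈ, so multiplication by any element P of
-- ℤ[γ] is given by an integer matrix C; the determinant trick for x·I − C,
-- carried out by fraction-free elimination, makes P a root of a monic
-- polynomial.  Hence L = |a|ᴱ works.

open import Defs
open import Level using (0ℓ)
open import Data.Nat using (ℕ; zero; suc; pred; _⊔_; _∸_; _>_; z≤n; s≤s; NonZero; ≢-nonZero)
  renaming (_+_ to _+ℕ_; _≤_ to _≤ℕ_; _<_ to _<ℕ_; _^_ to _^ℕ_)
import Data.Nat.Properties as ℕP
open import Data.Integer using (ℤ; 0ℤ; 1ℤ; -1ℤ; +_; ∣_∣; _^_)
  renaming (_+_ to _+ℤ_; _*_ to _*ℤ_; -_ to -ℤ_; _≟_ to _≟ℤ_)
import Data.Integer as ℤ using (NonZero; ≢-nonZero)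
import Data.Integer.Properties as ℤP
open import Data.Integer.DivMod using (_%_; _/_; a≡a%n+[a/n]*n; n%d<d)
import Data.Integer.Tactic.RingSolver as ℤ-Solver
open import Data.Fin using (Fin; zero; suc; toℕ; fromℕ; fromℕ<; inject₁)
import Data.Fin.Properties as FinP
open import Data.List using (List; []; _∷_; _++_; length)
open import Data.List.Relation.Unary.All using ([]; _∷_)
import Data.List.Properties as ListP
open import Data.Maybe using (Maybe; nothing; just)
open import Data.Product using (Σ; _×_; _,_; proj₁; proj₂)
open import Data.Sum using (_⊎_; inj₁; inj₂)
open import Data.Empty using (⊥-elim)
open import Function using (_∘_)
open import Relation.Binary.PropositionalEquality
  using (_≡_; _≢_; refl; sym; trans; cong; cong₂; subst; module ≡-Reasoning)
open import Relation.Binary.Bundles using (Setoid)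
open import Relation.Nullary using (¬_; yes; no)
open import Algebra.Bundles using (CommutativeRing)
open import Algebra.Structures using (IsCommutativeRing)
import Tactic.RingSolver.Core.AlmostCommutativeRing as ACR
open import Tactic.RingSolver using (solve-∀)
import Relation.Binary.Reasoning.Setoid as SetoidReasoning

coeff : Poly → ℕ → ℤ
coeff []      i       = 0ℤ
coeff (a ∷ p) zero    = a
coeff (a ∷ p) (suc i) = coeff p i

-- Coefficientwise equality: the intended equality of ℤ[x], insensitive to
-- trailing zeros.  It coincides with the ≈ₚ of Defs (≈ₚ⇒≋, ≋⇒≈ₚ below) but is
-- much easier to compute with.
infix 4 _≋_
record _≋_ (p q : Poly) : Set where
  constructor ≋i
  field at : ∀ i → coeff p i ≡ coeff q i
open _≋_ public

≋-refl : ∀ {p} → p ≋ p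
≋-refl = ≋i λ i → refl

≋-sym : ∀ {p q} → p ≋ q → q ≋ p
≋-sym e = ≋i λ i → sym (at e i)

≋-trans : ∀ {p q r} → p ≋ q → q ≋ r → p ≋ r
≋-trans e e' = ≋i λ i → trans (at e i) (at e' i)

∷-cong : ∀ {a b p q} → a ≡ b → p ≋ q → (a ∷ p) ≋ (b ∷ q)
∷-cong e e' = ≋i λ { zero → e ; (suc i) → at e' i }

∷-tail : ∀ {a b p q} → (a ∷ p) ≋ (b ∷ q) → p ≋ q
∷-tail e = ≋i λ i → at e (suc i)

coeff-+ : ∀ p q i → coeff (p +ₚ q) i ≡ coeff p i +ℤ coeff q i
coeff-+ []      q       i       = sym (ℤP.+-identityˡ _)
coeff-+ (a ∷ p) []      i       = sym (ℤP.+-identityʳ _)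
coeff-+ (a ∷ p) (b ∷ q) zero    = refl
coeff-+ (a ∷ p) (b ∷ q) (suc i) = coeff-+ p q i

coeff-neg : ∀ p i → coeff (-ₚ p) i ≡ -ℤ coeff p i
coeff-neg []      i       = refl
coeff-neg (b ∷ p) zero    = refl
coeff-neg (b ∷ p) (suc i) = coeff-neg p i

coeff-· : ∀ a p i → coeff (a ·ₚ p) i ≡ a *ℤ coeff p i
coeff-· a []      i       = sym (ℤP.*-zeroʳ a)
coeff-· a (b ∷ p) zero    = refl
coeff-· a (b ∷ p) (suc i) = coeff-· a p i

+-cong : ∀ {p p' q q'} → p ≋ p' → q ≋ q' → p +ₚ q ≋ p' +ₚ q'
+-cong {p} {p'} {q} {q'} e e' = ≋i λ i → begin
  coeff (p +ₚ q) i       ≡⟨ coeff-+ p q i ⟩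
  coeff p i +ℤ coeff q i ≡⟨ cong₂ _+ℤ_ (at e i) (at e' i) ⟩
  coeff p' i +ℤ coeff q' i ≡⟨ coeff-+ p' q' i ⟨
  coeff (p' +ₚ q') i     ∎
  where open ≡-Reasoning

neg-cong : ∀ {p q} → p ≋ q → -ₚ p ≋ -ₚ q
neg-cong {p} {q} e = ≋i λ i →
  trans (coeff-neg p i) (trans (cong -ℤ_ (at e i)) (sym (coeff-neg q i)))

+-comm : ∀ p q → p +ₚ q ≋ q +ₚ p
+-comm p q = ≋i λ i →
  trans (coeff-+ p q i) (trans (ℤP.+-comm (coeff p i) (coeff q i)) (sym (coeff-+ q p i)))

+-assoc : ∀ p q r → (p +ₚ q) +ₚ r ≋ p +ₚ (q +ₚ r)
+-assoc p q r = ≋i λ i → begin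
  coeff ((p +ₚ q) +ₚ r) i                  ≡⟨ coeff-+ (p +ₚ q) r i ⟩
  coeff (p +ₚ q) i +ℤ coeff r i            ≡⟨ cong (_+ℤ coeff r i) (coeff-+ p q i) ⟩
  (coeff p i +ℤ coeff q i) +ℤ coeff r i    ≡⟨ ℤP.+-assoc (coeff p i) (coeff q i) (coeff r i) ⟩
  coeff p i +ℤ (coeff q i +ℤ coeff r i)    ≡⟨ cong (coeff p i +ℤ_) (coeff-+ q r i) ⟨
  coeff p i +ℤ coeff (q +ₚ r) i            ≡⟨ coeff-+ p (q +ₚ r) i ⟨
  coeff (p +ₚ (q +ₚ r)) i                  ∎
  where open ≡-Reasoning

+-identityʳ : ∀ p → p +ₚ [] ≋ p
+-identityʳ []      = ≋-refl
+-identityʳ (a ∷ p) = ≋-refl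

+-inverseʳ : ∀ p → p +ₚ (-ₚ p) ≋ []
+-inverseʳ p = ≋i λ i →
  trans (coeff-+ p (-ₚ p) i) (trans (cong (coeff p i +ℤ_) (coeff-neg p i)) (ℤP.+-inverseʳ (coeff p i)))

+-interchange : ∀ A B C D → (A +ₚ B) +ₚ (C +ₚ D) ≋ (A +ₚ C) +ₚ (B +ₚ D)
+-interchange A B C D = ≋i λ i → begin
  coeff ((A +ₚ B) +ₚ (C +ₚ D)) i
    ≡⟨ trans (coeff-+ (A +ₚ B) (C +ₚ D) i) (cong₂ _+ℤ_ (coeff-+ A B i) (coeff-+ C D i)) ⟩
  (coeff A i +ℤ coeff B i) +ℤ (coeff C i +ℤ coeff D i)
    ≡⟨ interchangeℤ (coeff A i) (coeff B i) (coeff C i) (coeff D i) ⟩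
  (coeff A i +ℤ coeff C i) +ℤ (coeff B i +ℤ coeff D i)
    ≡⟨ trans (coeff-+ (A +ₚ C) (B +ₚ D) i) (cong₂ _+ℤ_ (coeff-+ A C i) (coeff-+ B D i)) ⟨
  coeff ((A +ₚ C) +ₚ (B +ₚ D)) i ∎
  where
  open ≡-Reasoning
  interchangeℤ : ∀ a b c d → (a +ℤ b) +ℤ (c +ℤ d) ≡ (a +ℤ c) +ℤ (b +ℤ d)
  interchangeℤ = ℤ-Solver.solve-∀

·-distrib-+ : ∀ a p q → a ·ₚ (p +ₚ q) ≋ a ·ₚ p +ₚ a ·ₚ q
·-distrib-+ a p q = ≋i λ i → begin
  coeff (a ·ₚ (p +ₚ q)) i                 ≡⟨ coeff-· a (p +ₚ q) i ⟩
  a *ℤ coeff (p +ₚ q) i                   ≡⟨ cong (a *ℤ_) (coeff-+ p q i) ⟩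
  a *ℤ (coeff p i +ℤ coeff q i)           ≡⟨ ℤP.*-distribˡ-+ a _ _ ⟩
  a *ℤ coeff p i +ℤ a *ℤ coeff q i        ≡⟨ cong₂ _+ℤ_ (coeff-· a p i) (coeff-· a q i) ⟨
  coeff (a ·ₚ p) i +ℤ coeff (a ·ₚ q) i    ≡⟨ coeff-+ (a ·ₚ p) (a ·ₚ q) i ⟨
  coeff (a ·ₚ p +ₚ a ·ₚ q) i              ∎
  where open ≡-Reasoning

+-distrib-· : ∀ a b p → (a +ℤ b) ·ₚ p ≋ a ·ₚ p +ₚ b ·ₚ p
+-distrib-· a b p = ≋i λ i → begin
  coeff ((a +ℤ b) ·ₚ p) i                 ≡⟨ coeff-· (a +ℤ b) p i ⟩
  (a +ℤ b) *ℤ coeff p i                   ≡⟨ ℤP.*-distribʳ-+ (coeff p i) a b ⟩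
  a *ℤ coeff p i +ℤ b *ℤ coeff p i        ≡⟨ cong₂ _+ℤ_ (coeff-· a p i) (coeff-· b p i) ⟨
  coeff (a ·ₚ p) i +ℤ coeff (b ·ₚ p) i    ≡⟨ coeff-+ (a ·ₚ p) (b ·ₚ p) i ⟨
  coeff (a ·ₚ p +ₚ b ·ₚ p) i              ∎
  where open ≡-Reasoning

·-assoc : ∀ a b p → a ·ₚ (b ·ₚ p) ≋ (a *ℤ b) ·ₚ p
·-assoc a b p = ≋i λ i → begin
  coeff (a ·ₚ (b ·ₚ p)) i    ≡⟨ coeff-· a (b ·ₚ p) i ⟩
  a *ℤ coeff (b ·ₚ p) i      ≡⟨ cong (a *ℤ_) (coeff-· b p i) ⟩
  a *ℤ (b *ℤ coeff p i)      ≡⟨ ℤP.*-assoc a b _ ⟨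
  (a *ℤ b) *ℤ coeff p i      ≡⟨ coeff-· (a *ℤ b) p i ⟨
  coeff ((a *ℤ b) ·ₚ p) i    ∎
  where open ≡-Reasoning

0·-zero : ∀ p → 0ℤ ·ₚ p ≋ []
0·-zero p = ≋i λ i → trans (coeff-· 0ℤ p i) (ℤP.*-zeroˡ (coeff p i))

-- Multiplication.  Its defining recursion is on the left factor, so the
-- laws are proved by induction on that factor; the right-hand versions
-- follow from commutativity.
zero∷ : ∀ {p} → p ≋ [] → (0ℤ ∷ p) ≋ []
zero∷ e = ≋i λ { zero → refl ; (suc i) → at e i }

zero-tail : ∀ {a p} → (a ∷ p) ≋ [] → p ≋ []
zero-tail e = ≋i λ i → at e (suc i)

*-zeroˡ : ∀ {p} q → p ≋ [] → p *ₚ q ≋ []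
*-zeroˡ {[]}    q e = ≋-refl
*-zeroˡ {a ∷ p} q e = ≋-trans (+-cong aq0 (zero∷ (*-zeroˡ q (zero-tail e)))) (+-identityʳ [])
  where
  aq0 : a ·ₚ q ≋ []
  aq0 = subst (λ z → z ·ₚ q ≋ []) (sym (at e zero)) (0·-zero q)

*-zeroʳ : ∀ p → p *ₚ [] ≋ []
*-zeroʳ []      = ≋-refl
*-zeroʳ (a ∷ p) = zero∷ (*-zeroʳ p)

*-congˡ : ∀ {p p'} q → p ≋ p' → p *ₚ q ≋ p' *ₚ q
*-congˡ {[]}    {p'}     q e = ≋-sym (*-zeroˡ q (≋-sym e))
*-congˡ {a ∷ p} {[]}     q e = *-zeroˡ q e
*-congˡ {a ∷ p} {b ∷ p'} q e =
  +-cong (subst (λ z → a ·ₚ q ≋ z ·ₚ q) (at e zero) ≋-refl)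
         (∷-cong refl (*-congˡ q (∷-tail e)))

*-distribʳ : ∀ p q r → (p +ₚ q) *ₚ r ≋ p *ₚ r +ₚ q *ₚ r
*-distribʳ []      q       r = ≋-refl
*-distribʳ (a ∷ p) []      r = ≋-sym (+-identityʳ _)
*-distribʳ (a ∷ p) (b ∷ q) r =
  ≋-trans (+-cong (+-distrib-· a b r) (∷-cong refl (*-distribʳ p q r)))
          (+-interchange (a ·ₚ r) (b ·ₚ r) (0ℤ ∷ (p *ₚ r)) (0ℤ ∷ (q *ₚ r)))

*-distribˡ : ∀ p q r → p *ₚ (q +ₚ r) ≋ p *ₚ q +ₚ p *ₚ r
*-distribˡ []      q r = ≋-refl
*-distribˡ (a ∷ p) q r =
  ≋-trans (+-cong (·-distrib-+ a q r) (∷-cong refl (*-distribˡ p q r)))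
          (+-interchange (a ·ₚ q) (a ·ₚ r) (0ℤ ∷ (p *ₚ q)) (0ℤ ∷ (p *ₚ r)))

*-∷ʳ : ∀ p b q → p *ₚ (b ∷ q) ≋ b ·ₚ p +ₚ (0ℤ ∷ (p *ₚ q))
*-∷ʳ []      b q = ≋i λ { zero → refl ; (suc i) → refl }
*-∷ʳ (a ∷ p) b q = ∷-cong head tail
  where
  open ≡-Reasoning
  head : a *ℤ b +ℤ 0ℤ ≡ b *ℤ a +ℤ 0ℤ
  head = cong (_+ℤ 0ℤ) (ℤP.*-comm a b)
  swap : ∀ x y z → x +ₚ (y +ₚ z) ≋ y +ₚ (x +ₚ z)
  swap x y z = ≋-trans (≋-sym (+-assoc x y z))
                (≋-trans (+-cong (+-comm x y) ≋-refl) (+-assoc y x z))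
  tail : a ·ₚ q +ₚ p *ₚ (b ∷ q) ≋ b ·ₚ p +ₚ (a ·ₚ q +ₚ (0ℤ ∷ (p *ₚ q)))
  tail = ≋-trans (+-cong ≋-refl (*-∷ʳ p b q)) (swap (a ·ₚ q) (b ·ₚ p) _)

*-comm : ∀ p q → p *ₚ q ≋ q *ₚ p
*-comm []      q = ≋-sym (*-zeroʳ q)
*-comm (a ∷ p) q = ≋-trans (+-cong ≋-refl (∷-cong refl (*-comm p q))) (≋-sym (*-∷ʳ q a p))

*-congʳ : ∀ p {q q'} → q ≋ q' → p *ₚ q ≋ p *ₚ q'
*-congʳ p {q} {q'} e = ≋-trans (*-comm p q) (≋-trans (*-congˡ p e) (*-comm q' p))

·-*-assoc : ∀ a q r → (a ·ₚ q) *ₚ r ≋ a ·ₚ (q *ₚ r)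
·-*-assoc a []      r = ≋-refl
·-*-assoc a (b ∷ q) r = ≋-trans (+-cong ≋-refl (∷-cong refl (·-*-assoc a q r))) (≋-sym unfold)
  where
  unfold : a ·ₚ (b ·ₚ r +ₚ (0ℤ ∷ (q *ₚ r))) ≋ (a *ℤ b) ·ₚ r +ₚ (0ℤ ∷ (a ·ₚ (q *ₚ r)))
  unfold = ≋-trans (·-distrib-+ a (b ·ₚ r) (0ℤ ∷ (q *ₚ r)))
                   (+-cong (·-assoc a b r) (∷-cong (ℤP.*-zeroʳ a) ≋-refl))

0∷-* : ∀ p r → (0ℤ ∷ p) *ₚ r ≋ 0ℤ ∷ (p *ₚ r)
0∷-* p r = +-cong (0·-zero r) ≋-refl

*-assoc : ∀ p q r → (p *ₚ q) *ₚ r ≋ p *ₚ (q *ₚ r)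
*-assoc []      q r = ≋-refl
*-assoc (a ∷ p) q r =
  ≋-trans (*-distribʳ (a ·ₚ q) (0ℤ ∷ (p *ₚ q)) r)
          (+-cong (·-*-assoc a q r) (≋-trans (0∷-* (p *ₚ q) r) (∷-cong refl (*-assoc p q r))))

*-identityˡ : ∀ p → const 1ℤ *ₚ p ≋ p
*-identityˡ p = ≋i λ i → begin
  coeff (1ℤ ·ₚ p +ₚ (0ℤ ∷ [])) i          ≡⟨ coeff-+ (1ℤ ·ₚ p) (0ℤ ∷ []) i ⟩
  coeff (1ℤ ·ₚ p) i +ℤ coeff (const 0ℤ) i ≡⟨ cong₂ _+ℤ_ (coeff-· 1ℤ p i) (coeff-const0 i) ⟩
  1ℤ *ℤ coeff p i +ℤ 0ℤ                   ≡⟨ ℤP.+-identityʳ _ ⟩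
  1ℤ *ℤ coeff p i                         ≡⟨ ℤP.*-identityˡ _ ⟩
  coeff p i                               ∎
  where
  open ≡-Reasoning
  coeff-const0 : ∀ i → coeff (const 0ℤ) i ≡ 0ℤ
  coeff-const0 zero    = refl
  coeff-const0 (suc i) = refl

*-identityʳ : ∀ p → p *ₚ const 1ℤ ≋ p
*-identityʳ p = ≋-trans (*-comm p _) (*-identityˡ p)

ℤ[x]-isCommutativeRing : IsCommutativeRing _≋_ _+ₚ_ _*ₚ_ -ₚ_ [] (const 1ℤ)
ℤ[x]-isCommutativeRing = record
  { isRing = record
    { +-isAbelianGroup = record
      { isGroup = record
        { isMonoid = record
          { isSemigroup = record
            { isMagma = record
              { isEquivalence = record { refl = ≋-refl ; sym = ≋-sym ; trans = ≋-trans }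
              ; ∙-cong = +-cong }
            ; assoc = +-assoc }
          ; identity = (λ p → ≋-refl) , +-identityʳ }
        ; inverse = (λ p → ≋-trans (+-comm (-ₚ p) p) (+-inverseʳ p)) , +-inverseʳ
        ; ⁻¹-cong = neg-cong }
      ; comm = +-comm }
    ; *-cong = λ {p} {p'} {q} e e' → ≋-trans (*-congˡ q e) (*-congʳ p' e')
    ; *-assoc = *-assoc
    ; *-identity = *-identityˡ , *-identityʳ
    ; distrib = *-distribˡ , (λ r p q → *-distribʳ p q r) }
  ; *-comm = *-comm }

ℤ[x] : CommutativeRing 0ℓ 0ℓ
ℤ[x] = record { isCommutativeRing = ℤ[x]-isCommutativeRing }

-- A (partial) zero test, which the ring solver uses to discard vanishing
-- coefficients of its normal forms.
zero? : (p : Poly) → Maybe ([] ≋ p)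
zero? []      = just ≋-refl
zero? (a ∷ p) with a ≟ℤ 0ℤ | zero? p
... | yes a≡0 | just 0≋p = just (≋i λ { zero → sym a≡0 ; (suc i) → at 0≋p i })
... | _       | _        = nothing

ℤ[x]-solverRing : ACR.AlmostCommutativeRing 0ℓ 0ℓ
ℤ[x]-solverRing = ACR.fromCommutativeRing ℤ[x] zero?

module ≋-Reasoning = SetoidReasoning (CommutativeRing.setoid ℤ[x])

IsZeroₚ⇒≋[] : ∀ {z} → IsZeroₚ z → z ≋ []
IsZeroₚ⇒≋[] []       = ≋-refl
IsZeroₚ⇒≋[] (e ∷ z0) = ≋i λ { zero → e ; (suc i) → at (IsZeroₚ⇒≋[] z0) i }

≋[]⇒IsZeroₚ : ∀ {z} → z ≋ [] → IsZeroₚ z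
≋[]⇒IsZeroₚ {[]}    e = []
≋[]⇒IsZeroₚ {x ∷ z} e = at e zero ∷ ≋[]⇒IsZeroₚ (zero-tail e)

≈ₚ⇒≋ : ∀ {p q} → p ≈ₚ q → p ≋ q
≈ₚ⇒≋ {p} {q} e = begin
  p                 ≈⟨ split p q ⟩
  (p -ₚ q) +ₚ q     ≈⟨ +-cong (IsZeroₚ⇒≋[] e) ≋-refl ⟩
  q                 ∎
  where
  open ≋-Reasoning
  split : ∀ p q → p ≋ (p -ₚ q) +ₚ q
  split = solve-∀ ℤ[x]-solverRing

≋⇒≈ₚ : ∀ {p q} → p ≋ q → p ≈ₚ q
≋⇒≈ₚ {p} {q} e = ≋[]⇒IsZeroₚ (≋-trans (+-cong e ≋-refl) (+-inverseʳ q))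

-- Congruence modulo f: the equality of ℤ[α] = ℤ[x]/(f), stated with ≋ so
-- that the ring solver applies.  It agrees with ≡[ f ] of Defs.
module Modulo (f : Poly) where

  infix 4 _∼_
  record _∼_ (p q : Poly) : Set where
    constructor mk∼
    field
      quot : Poly
      eq   : p ≋ q +ₚ quot *ₚ f
  open _∼_ public

  ≋⇒∼ : ∀ {p q} → p ≋ q → p ∼ q
  ≋⇒∼ {p} {q} e = mk∼ [] (≋-trans e (≋-sym (+-identityʳ q)))

  ∼-refl : ∀ {p} → p ∼ p
  ∼-refl = ≋⇒∼ ≋-refl

  ∼-sym : ∀ {p q} → p ∼ q → q ∼ p
  ∼-sym {p} {q} (mk∼ h e) = mk∼ (-ₚ h) (begin
    q                              ≈⟨ cancel q h f ⟩
    (q +ₚ h *ₚ f) +ₚ (-ₚ h) *ₚ f   ≈⟨ +-cong e ≋-refl ⟨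
    p +ₚ (-ₚ h) *ₚ f               ∎)
    where
    open ≋-Reasoning
    cancel : ∀ q h f → q ≋ (q +ₚ h *ₚ f) +ₚ (-ₚ h) *ₚ f
    cancel = solve-∀ ℤ[x]-solverRing

  ∼-trans : ∀ {p q r} → p ∼ q → q ∼ r → p ∼ r
  ∼-trans {p} {q} {r} (mk∼ h e) (mk∼ k e') = mk∼ (k +ₚ h) (begin
    p                              ≈⟨ e ⟩
    q +ₚ h *ₚ f                    ≈⟨ +-cong e' ≋-refl ⟩
    (r +ₚ k *ₚ f) +ₚ h *ₚ f        ≈⟨ collect r k h f ⟩
    r +ₚ (k +ₚ h) *ₚ f             ∎)
    where
    open ≋-Reasoning
    collect : ∀ r k h f → (r +ₚ k *ₚ f) +ₚ h *ₚ f ≋ r +ₚ (k +ₚ h) *ₚ f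
    collect = solve-∀ ℤ[x]-solverRing

  ∼-+ : ∀ {p p' q q'} → p ∼ p' → q ∼ q' → p +ₚ q ∼ p' +ₚ q'
  ∼-+ {p} {p'} {q} {q'} (mk∼ h e) (mk∼ k e') = mk∼ (h +ₚ k) (begin
    p +ₚ q                                ≈⟨ +-cong e e' ⟩
    (p' +ₚ h *ₚ f) +ₚ (q' +ₚ k *ₚ f)      ≈⟨ collect p' h q' k f ⟩
    (p' +ₚ q') +ₚ (h +ₚ k) *ₚ f           ∎)
    where
    open ≋-Reasoning
    collect : ∀ p' h q' k f → (p' +ₚ h *ₚ f) +ₚ (q' +ₚ k *ₚ f) ≋ (p' +ₚ q') +ₚ (h +ₚ k) *ₚ f
    collect = solve-∀ ℤ[x]-solverRing

  ∼-* : ∀ {p p' q q'} → p ∼ p' → q ∼ q' → p *ₚ q ∼ p' *ₚ q'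
  ∼-* {p} {p'} {q} {q'} (mk∼ h e) (mk∼ k e') =
    mk∼ (h *ₚ q' +ₚ p' *ₚ k +ₚ h *ₚ k *ₚ f) (begin
    p *ₚ q                                ≈⟨ ≋-trans (*-congˡ q e) (*-congʳ (p' +ₚ h *ₚ f) e') ⟩
    (p' +ₚ h *ₚ f) *ₚ (q' +ₚ k *ₚ f)      ≈⟨ expand p' h q' k f ⟩
    p' *ₚ q' +ₚ (h *ₚ q' +ₚ p' *ₚ k +ₚ h *ₚ k *ₚ f) *ₚ f ∎)
    where
    open ≋-Reasoning
    expand : ∀ p' h q' k f →
      (p' +ₚ h *ₚ f) *ₚ (q' +ₚ k *ₚ f) ≋ p' *ₚ q' +ₚ (h *ₚ q' +ₚ p' *ₚ k +ₚ h *ₚ k *ₚ f) *ₚ f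
    expand = solve-∀ ℤ[x]-solverRing

  ∼-neg : ∀ {p q} → p ∼ q → -ₚ p ∼ -ₚ q
  ∼-neg {p} {q} (mk∼ h e) = mk∼ (-ₚ h) (begin
    -ₚ p                          ≈⟨ neg-cong e ⟩
    -ₚ (q +ₚ h *ₚ f)              ≈⟨ distrib q h f ⟩
    (-ₚ q) +ₚ (-ₚ h) *ₚ f         ∎)
    where
    open ≋-Reasoning
    distrib : ∀ q h f → -ₚ (q +ₚ h *ₚ f) ≋ (-ₚ q) +ₚ (-ₚ h) *ₚ f
    distrib = solve-∀ ℤ[x]-solverRing

  ∼-setoid : Setoid 0ℓ 0ℓ
  ∼-setoid = record
    { Carrier = Poly ; _≈_ = _∼_
    ; isEquivalence = record { refl = ∼-refl ; sym = ∼-sym ; trans = ∼-trans } }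

  module ∼-Reasoning = SetoidReasoning ∼-setoid

  ∼⇒≡[f] : ∀ {p q} → p ∼ q → p ≡[ f ] q
  ∼⇒≡[f] {p} {q} (mk∼ h e) = h , ≋⇒≈ₚ (begin
    p -ₚ q                        ≈⟨ +-cong e ≋-refl ⟩
    (q +ₚ h *ₚ f) -ₚ q            ≈⟨ cancel q h f ⟩
    h *ₚ f                        ∎)
    where
    open ≋-Reasoning
    cancel : ∀ q h f → (q +ₚ h *ₚ f) -ₚ q ≋ h *ₚ f
    cancel = solve-∀ ℤ[x]-solverRing

  ≡[f]⇒∼ : ∀ {p q} → p ≡[ f ] q → p ∼ q
  ≡[f]⇒∼ {p} {q} (h , e) = mk∼ h (begin
    p                             ≈⟨ split p q ⟩
    (p -ₚ q) +ₚ q                 ≈⟨ +-cong (≈ₚ⇒≋ {p -ₚ q} {h *ₚ f} e) ≋-refl ⟩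
    h *ₚ f +ₚ q                   ≈⟨ +-comm (h *ₚ f) q ⟩
    q +ₚ h *ₚ f                   ∎)
    where
    open ≋-Reasoning
    split : ∀ p q → p ≋ (p -ₚ q) +ₚ q
    split = solve-∀ ℤ[x]-solverRing

const-* : ∀ a b → const (a *ℤ b) ≋ const a *ₚ const b
const-* a b = ≋i λ { zero → sym (ℤP.+-identityʳ _) ; (suc i) → refl }

·≋const* : ∀ c p → c ·ₚ p ≋ const c *ₚ p
·≋const* c p = ≋-sym (≋-trans (+-cong ≋-refl (zero∷ ≋-refl)) (+-identityʳ (c ·ₚ p)))

evalAt-zero : ∀ {g} p → g ≋ [] → evalAt g p ≋ []
evalAt-zero {[]}    p e = ≋-refl
evalAt-zero {a ∷ g} p e =
  ≋-trans (+-cong (≋i λ { zero → at e zero ; (suc i) → refl })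
                  (*-congʳ p (evalAt-zero p (zero-tail e))))
          (*-zeroʳ p)

evalAt-congˡ : ∀ {g g'} p → g ≋ g' → evalAt g p ≋ evalAt g' p
evalAt-congˡ {[]}    {g'}     p e = ≋-sym (evalAt-zero p (≋-sym e))
evalAt-congˡ {a ∷ g} {[]}     p e = evalAt-zero p e
evalAt-congˡ {a ∷ g} {b ∷ g'} p e =
  +-cong (∷-cong (at e zero) ≋-refl) (*-congʳ p (evalAt-congˡ p (∷-tail e)))

evalAt-+ : ∀ g h p → evalAt (g +ₚ h) p ≋ evalAt g p +ₚ evalAt h p
evalAt-+ []      h       p = ≋-refl
evalAt-+ (a ∷ g) []      p = ≋-sym (+-identityʳ _)
evalAt-+ (a ∷ g) (b ∷ h) p = begin
  const (a +ℤ b) +ₚ p *ₚ evalAt (g +ₚ h) p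
    ≈⟨ +-cong ≋-refl (*-congʳ p (evalAt-+ g h p)) ⟩
  (const a +ₚ const b) +ₚ p *ₚ (evalAt g p +ₚ evalAt h p)
    ≈⟨ regroup (const a) (const b) p (evalAt g p) (evalAt h p) ⟩
  (const a +ₚ p *ₚ evalAt g p) +ₚ (const b +ₚ p *ₚ evalAt h p) ∎
  where
  open ≋-Reasoning
  regroup : ∀ A B p G H → (A +ₚ B) +ₚ p *ₚ (G +ₚ H) ≋ (A +ₚ p *ₚ G) +ₚ (B +ₚ p *ₚ H)
  regroup = solve-∀ ℤ[x]-solverRing

evalAt-neg : ∀ g p → evalAt (-ₚ g) p ≋ -ₚ evalAt g p
evalAt-neg []      p = ≋-refl
evalAt-neg (a ∷ g) p = begin
  const (-ℤ a) +ₚ p *ₚ evalAt (-ₚ g) p   ≈⟨ +-cong ≋-refl (*-congʳ p (evalAt-neg g p)) ⟩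
  -ₚ const a +ₚ p *ₚ (-ₚ evalAt g p)     ≈⟨ regroup (const a) p (evalAt g p) ⟩
  -ₚ (const a +ₚ p *ₚ evalAt g p)        ∎
  where
  open ≋-Reasoning
  regroup : ∀ A p G → -ₚ A +ₚ p *ₚ (-ₚ G) ≋ -ₚ (A +ₚ p *ₚ G)
  regroup = solve-∀ ℤ[x]-solverRing

evalAt-· : ∀ c g p → evalAt (c ·ₚ g) p ≋ const c *ₚ evalAt g p
evalAt-· c []      p = ≋-sym (*-zeroʳ (const c))
evalAt-· c (a ∷ g) p = begin
  const (c *ℤ a) +ₚ p *ₚ evalAt (c ·ₚ g) p
    ≈⟨ +-cong (const-* c a) (*-congʳ p (evalAt-· c g p)) ⟩
  const c *ₚ const a +ₚ p *ₚ (const c *ₚ evalAt g p)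
    ≈⟨ regroup (const c) (const a) p (evalAt g p) ⟩
  const c *ₚ (const a +ₚ p *ₚ evalAt g p) ∎
  where
  open ≋-Reasoning
  regroup : ∀ C A p G → C *ₚ A +ₚ p *ₚ (C *ₚ G) ≋ C *ₚ (A +ₚ p *ₚ G)
  regroup = solve-∀ ℤ[x]-solverRing

evalAt-* : ∀ g h p → evalAt (g *ₚ h) p ≋ evalAt g p *ₚ evalAt h p
evalAt-* []      h p = ≋-refl
evalAt-* (a ∷ g) h p = begin
  evalAt (a ·ₚ h +ₚ (0ℤ ∷ (g *ₚ h))) p
    ≈⟨ evalAt-+ (a ·ₚ h) (0ℤ ∷ (g *ₚ h)) p ⟩
  evalAt (a ·ₚ h) p +ₚ (const 0ℤ +ₚ p *ₚ evalAt (g *ₚ h) p)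
    ≈⟨ +-cong (evalAt-· a h p) (+-cong (zero∷ ≋-refl) (*-congʳ p (evalAt-* g h p))) ⟩
  const a *ₚ evalAt h p +ₚ ([] +ₚ p *ₚ (evalAt g p *ₚ evalAt h p))
    ≈⟨ regroup (const a) p (evalAt g p) (evalAt h p) ⟩
  (const a +ₚ p *ₚ evalAt g p) *ₚ evalAt h p ∎
  where
  open ≋-Reasoning
  regroup : ∀ A p G H → A *ₚ H +ₚ ([] +ₚ p *ₚ (G *ₚ H)) ≋ (A +ₚ p *ₚ G) *ₚ H
  regroup = solve-∀ ℤ[x]-solverRing

evalAt-const : ∀ c p → evalAt (const c) p ≋ const c
evalAt-const c p = ≋-trans (+-cong ≋-refl (*-zeroʳ p)) (+-identityʳ (const c))

evalAt-X : ∀ p → evalAt X p ≋ p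
evalAt-X p = ≋-trans (+-cong (zero∷ ≋-refl) (*-congʳ p (evalAt-const 1ℤ p))) (*-identityʳ p)

module _ (f : Poly) where
  open Modulo f

  evalAt-congʳ : ∀ g {p p'} → p ∼ p' → evalAt g p ∼ evalAt g p'
  evalAt-congʳ []      e = ∼-refl
  evalAt-congʳ (a ∷ g) e = ∼-+ ∼-refl (∼-* e (evalAt-congʳ g e))

∑ : (n : ℕ) → (Fin n → Poly) → Poly
∑ zero    g = []
∑ (suc n) g = g zero +ₚ ∑ n (g ∘ suc)

∑-cong : ∀ n {g h} → (∀ j → g j ≋ h j) → ∑ n g ≋ ∑ n h
∑-cong zero    e = ≋-refl
∑-cong (suc n) e = +-cong (e zero) (∑-cong n (e ∘ suc))

∑-zero : ∀ n {g : Fin n → Poly} → (∀ j → g j ≋ []) → ∑ n g ≋ []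
∑-zero zero    e = ≋-refl
∑-zero (suc n) e = +-cong (e zero) (∑-zero n (e ∘ suc))

∑-+ : ∀ n (g h : Fin n → Poly) → ∑ n (λ j → g j +ₚ h j) ≋ ∑ n g +ₚ ∑ n h
∑-+ zero    g h = ≋-refl
∑-+ (suc n) g h = ≋-trans (+-cong ≋-refl (∑-+ n (g ∘ suc) (h ∘ suc)))
                          (+-interchange (g zero) (h zero) (∑ n (g ∘ suc)) (∑ n (h ∘ suc)))

∑-*ˡ : ∀ n c (g : Fin n → Poly) → c *ₚ ∑ n g ≋ ∑ n (λ j → c *ₚ g j)
∑-*ˡ zero    c g = *-zeroʳ c
∑-*ˡ (suc n) c g = ≋-trans (*-distribˡ c (g zero) (∑ n (g ∘ suc))) (+-cong ≋-refl (∑-*ˡ n c (g ∘ suc)))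

∑-neg : ∀ n (g : Fin n → Poly) → -ₚ ∑ n g ≋ ∑ n (λ j → -ₚ g j)
∑-neg zero    g = ≋-refl
∑-neg (suc n) g = ≋-trans (neg-+ (g zero) (∑ n (g ∘ suc))) (+-cong ≋-refl (∑-neg n (g ∘ suc)))
  where
  neg-+ : ∀ a b → -ₚ (a +ₚ b) ≋ -ₚ a +ₚ -ₚ b
  neg-+ = solve-∀ ℤ[x]-solverRing

∑-last : ∀ n g → ∑ (suc n) g ≋ ∑ n (g ∘ inject₁) +ₚ g (fromℕ n)
∑-last zero    g = +-comm (g zero) []
∑-last (suc n) g = ≋-trans (+-cong (≋-refl {g zero}) (∑-last n (g ∘ suc)))
                           (≋-sym (+-assoc (g zero) (∑ n (g ∘ suc ∘ inject₁)) (g (fromℕ (suc n)))))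

Xp : ℕ → Poly
Xp zero    = const 1ℤ
Xp (suc k) = 0ℤ ∷ Xp k

Xp-* : ∀ a b → Xp a *ₚ Xp b ≋ Xp (a +ℕ b)
Xp-* zero    b = *-identityˡ (Xp b)
Xp-* (suc a) b = ≋-trans (0∷-* (Xp a) (Xp b)) (∷-cong refl (Xp-* a b))

pow : Poly → ℕ → Poly
pow p zero    = const 1ℤ
pow p (suc n) = p *ₚ pow p n

record Deg< (p : Poly) (k : ℕ) : Set where
  constructor mkDeg<
  field vanish : ∀ i → k ≤ℕ i → coeff p i ≡ 0ℤ
open Deg< public

Deg<-resp : ∀ {p q k} → p ≋ q → Deg< p k → Deg< q k
Deg<-resp e d = mkDeg< λ i le → trans (sym (at e i)) (vanish d i le)

Deg<-mono : ∀ {p k k'} → k ≤ℕ k' → Deg< p k → Deg< p k'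
Deg<-mono le d = mkDeg< λ i le' → vanish d i (ℕP.≤-trans le le')

Deg<-[] : ∀ {k} → Deg< [] k
Deg<-[] = mkDeg< λ i le → refl

Deg<0 : ∀ {p} → Deg< p 0 → p ≋ []
Deg<0 d = ≋i λ i → vanish d i z≤n

Deg<-const : ∀ c → Deg< (const c) 1
Deg<-const c = mkDeg< λ { zero () ; (suc i) le → refl }

Deg<-tail : ∀ {c p k} → Deg< (c ∷ p) (suc k) → Deg< p k
Deg<-tail d = mkDeg< λ i le → vanish d (suc i) (s≤s le)

Deg<-∷ : ∀ {c p k} → Deg< p k → Deg< (c ∷ p) (suc k)
Deg<-∷ d = mkDeg< λ { zero () ; (suc i) (s≤s le) → vanish d i le }

Deg<-+ : ∀ {p q k} → Deg< p k → Deg< q k → Deg< (p +ₚ q) k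
Deg<-+ {p} {q} dp dq = mkDeg< λ i le →
  trans (coeff-+ p q i) (cong₂ _+ℤ_ (vanish dp i le) (vanish dq i le))

Deg<-neg : ∀ {p k} → Deg< p k → Deg< (-ₚ p) k
Deg<-neg {p} dp = mkDeg< λ i le → trans (coeff-neg p i) (cong -ℤ_ (vanish dp i le))

Deg<-- : ∀ {p q k} → Deg< p k → Deg< q k → Deg< (p -ₚ q) k
Deg<-- dp dq = Deg<-+ dp (Deg<-neg dq)

Deg<-· : ∀ {p k} c → Deg< p k → Deg< (c ·ₚ p) k
Deg<-· {p} c dp = mkDeg< λ i le →
  trans (coeff-· c p i) (trans (cong (c *ℤ_) (vanish dp i le)) (ℤP.*-zeroʳ c))

Deg<-* : ∀ {p q} a b → Deg< p (suc a) → Deg< q b → Deg< (p *ₚ q) (a +ℕ b)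
Deg<-* {[]}    a       b dp dq = Deg<-[]
Deg<-* {c ∷ p} {q} zero b dp dq =
  Deg<-+ (Deg<-· c dq) (Deg<-resp (≋-sym (zero∷ (*-zeroˡ q (Deg<0 (Deg<-tail dp))))) Deg<-[])
Deg<-* {c ∷ p} (suc a) b dp dq =
  Deg<-+ (Deg<-mono (ℕP.m≤n+m b (suc a)) (Deg<-· c dq)) (Deg<-∷ (Deg<-* a b (Deg<-tail dp) dq))

Deg<-length : ∀ p → Deg< p (length p)
Deg<-length []      = Deg<-[]
Deg<-length (c ∷ p) = Deg<-∷ (Deg<-length p)

Deg<-Xp : ∀ k → Deg< (Xp k) (suc k)
Deg<-Xp zero    = Deg<-const 1ℤ
Deg<-Xp (suc k) = Deg<-∷ (Deg<-Xp k)

MonicOfDegree : ℕ → Poly → Set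
MonicOfDegree k p = Σ Poly λ r → (p ≋ Xp k +ₚ r) × Deg< r k

MonicOfDegree⇒Monic : ∀ k {p} → MonicOfDegree k p → Σ Poly λ g → Monic g × (g ≋ p)
MonicOfDegree⇒Monic k {p} (r , p≋ , dr) = lower k r ++ (1ℤ ∷ []) , (lower k r , refl) ,
  ≋-trans (lower++1 k r dr) (≋-sym p≋)
  where
  lower : ℕ → Poly → Poly
  lower zero    r       = []
  lower (suc k) []      = 0ℤ ∷ lower k []
  lower (suc k) (c ∷ r) = c ∷ lower k r

  lower++1 : ∀ k r → Deg< r k → lower k r ++ (1ℤ ∷ []) ≋ Xp k +ₚ r
  lower++1 zero    r       dr = ≋i λ
    { zero    → sym (trans (coeff-+ (Xp 0) r 0) (cong (1ℤ +ℤ_) (vanish dr 0 z≤n)))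
    ; (suc i) → sym (trans (coeff-+ (Xp 0) r (suc i)) (trans (ℤP.+-identityˡ _) (vanish dr (suc i) z≤n))) }
  lower++1 (suc k) []      dr = ∷-cong refl (≋-trans (lower++1 k [] Deg<-[]) (+-identityʳ (Xp k)))
  lower++1 (suc k) (c ∷ r) dr = ∷-cong (sym (ℤP.+-identityˡ c)) (lower++1 k r (Deg<-tail dr))

leading-term : ∀ p → (p ≋ []) ⊎ Σ ℕ λ d → Σ ℤ λ a → Σ Poly λ f' →
               (a ≢ 0ℤ) × Deg< f' d × (p ≋ f' +ₚ Xp d *ₚ const a)
leading-term []      = inj₁ ≋-refl
leading-term (c ∷ p) with leading-term p
... | inj₂ (d , a , f' , a≢0 , deg-f' , p≋) =
  inj₂ (suc d , a , c ∷ f' , a≢0 , Deg<-∷ deg-f' ,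
        ≋-trans (∷-cong (sym (ℤP.+-identityʳ c)) p≋) (+-cong (≋-refl {c ∷ f'}) (≋-sym (0∷-* (Xp d) (const a)))))
... | inj₁ p≋0 with c ≟ℤ 0ℤ
...   | yes c≡0 = inj₁ (≋i λ { zero → c≡0 ; (suc i) → at p≋0 i })
...   | no  c≢0 = inj₂ (0 , c , [] , c≢0 , Deg<-[] , ≋-trans (∷-cong refl p≋0) (≋-sym (*-identityˡ (const c))))

∑-lincomb : ∀ n a b (g h w : Fin n → Poly) →
  ∑ n (λ j → (a *ₚ g j -ₚ b *ₚ h j) *ₚ w j) ≋ a *ₚ ∑ n (λ j → g j *ₚ w j) -ₚ b *ₚ ∑ n (λ j → h j *ₚ w j)
∑-lincomb zero    a b g h w = zeros a b
  where
  zeros : ∀ a b → [] ≋ a *ₚ [] -ₚ b *ₚ []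
  zeros = solve-∀ ℤ[x]-solverRing
∑-lincomb (suc n) a b g h w =
  ≋-trans (+-cong ≋-refl (∑-lincomb n a b (g ∘ suc) (h ∘ suc) (w ∘ suc)))
          (regroup a b (g zero) (h zero) (w zero) (∑ n (λ j → g (suc j) *ₚ w (suc j)))
                   (∑ n (λ j → h (suc j) *ₚ w (suc j))))
  where
  regroup : ∀ a b G H W S T →
    (a *ₚ G -ₚ b *ₚ H) *ₚ W +ₚ (a *ₚ S -ₚ b *ₚ T) ≋ a *ₚ (G *ₚ W +ₚ S) -ₚ b *ₚ (H *ₚ W +ₚ T)
  regroup = solve-∀ ℤ[x]-solverRing

-- The determinant trick, done by fraction-free Gaussian elimination.
-- Let N be an n×n matrix of integer polynomials whose diagonal entries are
-- monic of degree k and whose other entries have degree < k, and suppose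
-- the vector v satisfies N(P) v ≡ 0 (mod f).  Eliminating the last
-- unknown (multiplying the rows by the pivot N(P)ₗₗ) gives a system of
-- the same shape of size n − 1 and degree 2k; at size 1 we are left with
-- g(P) v₀ ≡ 0 for a monic g.
module Elimination (f P : Poly) where
  open Modulo f

  Matrix : ℕ → Set
  Matrix n = Fin n → Fin n → Poly

  MonicSystem : ℕ → (n : ℕ) → Matrix n → Set
  MonicSystem k n N = (∀ i → MonicOfDegree k (N i i)) × (∀ i j → i ≢ j → Deg< (N i j) k)

  Solves : (n : ℕ) → Matrix n → (Fin n → Poly) → Set
  Solves n N v = ∀ i → ∑ n (λ j → evalAt (N i j) P *ₚ v j) ∼ []

  private
    evalAt-det₂ : ∀ A B C D →
      evalAt (A *ₚ B -ₚ C *ₚ D) P ≋ evalAt A P *ₚ evalAt B P -ₚ evalAt C P *ₚ evalAt D P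
    evalAt-det₂ A B C D =
      ≋-trans (evalAt-+ (A *ₚ B) (-ₚ (C *ₚ D)) P)
              (+-cong (evalAt-* A B P) (≋-trans (evalAt-neg (C *ₚ D) P) (neg-cong (evalAt-* C D P))))

  module Pivot {m : ℕ} (N : Matrix (suc (suc m))) where
    last : Fin (suc (suc m))
    last = fromℕ (suc m)

    inject≢last : ∀ i → inject₁ i ≢ last
    inject≢last i e = FinP.fromℕ≢inject₁ (sym e)

    reduced : Matrix (suc m)
    reduced i j = N last last *ₚ N (inject₁ i) (inject₁ j) -ₚ N (inject₁ i) last *ₚ N last (inject₁ j)

    reduced-monic : ∀ k → MonicSystem (suc k) (suc (suc m)) N → MonicSystem (suc k +ℕ suc k) (suc m) reduced
    reduced-monic k (diag , off) = diag′ , off′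
      where
      K : ℕ
      K = suc k
      rₗ : Poly
      rₗ = proj₁ (diag last)
      Nₗₗ≋ : N last last ≋ Xp K +ₚ rₗ
      Nₗₗ≋ = proj₁ (proj₂ (diag last))
      dₗ : Deg< rₗ K
      dₗ = proj₂ (proj₂ (diag last))
      Deg<-small² : ∀ {x y} → Deg< x K → Deg< y K → Deg< (x *ₚ y) (K +ℕ K)
      Deg<-small² dx dy = Deg<-mono (ℕP.n≤1+n (k +ℕ K)) (Deg<-* k K dx dy)
      Deg<-XK* : ∀ {y} → Deg< y K → Deg< (Xp K *ₚ y) (K +ℕ K)
      Deg<-XK* dy = Deg<-* K K (Deg<-Xp K) dy
      diag′ : ∀ i → MonicOfDegree (K +ℕ K) (reduced i i)
      diag′ i with diag (inject₁ i)
      ... | rᵢ , Nᵢᵢ≋ , dᵢ = (Xp K *ₚ rᵢ +ₚ rₗ *ₚ Xp K +ₚ rₗ *ₚ rᵢ -ₚ A *ₚ B) , expand , degree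
        where
        A B : Poly
        A = N (inject₁ i) last
        B = N last (inject₁ i)
        product : ∀ XK rₗ rᵢ A B → (XK +ₚ rₗ) *ₚ (XK +ₚ rᵢ) -ₚ A *ₚ B ≋
                  XK *ₚ XK +ₚ (XK *ₚ rᵢ +ₚ rₗ *ₚ XK +ₚ rₗ *ₚ rᵢ -ₚ A *ₚ B)
        product = solve-∀ ℤ[x]-solverRing
        expand : reduced i i ≋ Xp (K +ℕ K) +ₚ (Xp K *ₚ rᵢ +ₚ rₗ *ₚ Xp K +ₚ rₗ *ₚ rᵢ -ₚ A *ₚ B)
        expand = ≋-trans (+-cong (≋-trans (*-congˡ _ Nₗₗ≋) (*-congʳ (Xp K +ₚ rₗ) Nᵢᵢ≋)) (≋-refl { -ₚ (A *ₚ B)}))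
                 (≋-trans (product (Xp K) rₗ rᵢ A B) (+-cong (Xp-* K K) (≋-refl {Xp K *ₚ rᵢ +ₚ rₗ *ₚ Xp K +ₚ rₗ *ₚ rᵢ -ₚ A *ₚ B})))
        degree : Deg< (Xp K *ₚ rᵢ +ₚ rₗ *ₚ Xp K +ₚ rₗ *ₚ rᵢ -ₚ A *ₚ B) (K +ℕ K)
        degree = Deg<-- (Deg<-+ (Deg<-+ (Deg<-XK* dᵢ) (Deg<-resp (*-comm (Xp K) rₗ) (Deg<-XK* dₗ)))
                                (Deg<-small² dₗ dᵢ))
                        (Deg<-small² (off (inject₁ i) last (inject≢last i))
                                     (off last (inject₁ i) (inject≢last i ∘ sym)))
      off′ : ∀ i j → i ≢ j → Deg< (reduced i j) (K +ℕ K)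
      off′ i j i≢j = Deg<-resp (≋-sym expand) degree
        where
        A B C : Poly
        C = N (inject₁ i) (inject₁ j)
        A = N (inject₁ i) last
        B = N last (inject₁ j)
        product : ∀ XK rₗ C A B → (XK +ₚ rₗ) *ₚ C -ₚ A *ₚ B ≋ XK *ₚ C +ₚ rₗ *ₚ C -ₚ A *ₚ B
        product = solve-∀ ℤ[x]-solverRing
        expand : reduced i j ≋ Xp K *ₚ C +ₚ rₗ *ₚ C -ₚ A *ₚ B
        expand = ≋-trans (+-cong (*-congˡ C Nₗₗ≋) (≋-refl { -ₚ (A *ₚ B)})) (product (Xp K) rₗ C A B)
        dC : Deg< C K
        dC = off (inject₁ i) (inject₁ j) (i≢j ∘ FinP.inject₁-injective)
        degree : Deg< (Xp K *ₚ C +ₚ rₗ *ₚ C -ₚ A *ₚ B) (K +ℕ K)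
        degree = Deg<-- (Deg<-+ (Deg<-XK* dC) (Deg<-small² dₗ dC))
                        (Deg<-small² (off (inject₁ i) last (inject≢last i))
                                     (off last (inject₁ j) (inject≢last j ∘ sym)))

    -- Row i of the reduced system is  Nₗₗ·(row i) − Nᵢₗ·(row l)  of the old one.
    reduced-solves : ∀ v → Solves (suc (suc m)) N v → Solves (suc m) reduced (v ∘ inject₁)
    reduced-solves v sol i = begin
      ∑ (suc m) (λ j → evalAt (reduced i j) P *ₚ v (inject₁ j))
        ≈⟨ ≋⇒∼ (≋-trans (∑-cong (suc m) (λ j → *-congˡ (v (inject₁ j))
                              (evalAt-det₂ (N last last) (N (inject₁ i) (inject₁ j)) (N (inject₁ i) last) (N last (inject₁ j)))))
                          (∑-lincomb (suc m) a b (λ j → ev (N (inject₁ i) (inject₁ j)))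
                                     (λ j → ev (N last (inject₁ j))) (v ∘ inject₁))) ⟩
      a *ₚ S₁ -ₚ b *ₚ S₂
        ≈⟨ ≋⇒∼ (complete a b S₁ S₂ (v last)) ⟩
      a *ₚ (S₁ +ₚ b *ₚ v last) -ₚ b *ₚ (S₂ +ₚ a *ₚ v last)
        ≈⟨ ∼-+ (∼-* (∼-refl {a}) rowᵢ) (∼-neg (∼-* (∼-refl {b}) rowₗ)) ⟩
      a *ₚ [] -ₚ b *ₚ []
        ≈⟨ ≋⇒∼ (zeros a b) ⟩
      [] ∎
      where
      open ∼-Reasoning
      ev : Poly → Poly
      ev g = evalAt g P
      a b S₁ S₂ : Poly
      a = ev (N last last)
      b = ev (N (inject₁ i) last)
      S₁ = ∑ (suc m) (λ j → ev (N (inject₁ i) (inject₁ j)) *ₚ v (inject₁ j))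
      S₂ = ∑ (suc m) (λ j → ev (N last (inject₁ j)) *ₚ v (inject₁ j))
      complete : ∀ a b S₁ S₂ V → a *ₚ S₁ -ₚ b *ₚ S₂ ≋ a *ₚ (S₁ +ₚ b *ₚ V) -ₚ b *ₚ (S₂ +ₚ a *ₚ V)
      complete = solve-∀ ℤ[x]-solverRing
      zeros : ∀ a b → a *ₚ [] -ₚ b *ₚ [] ≋ []
      zeros = solve-∀ ℤ[x]-solverRing
      rowᵢ : S₁ +ₚ b *ₚ v last ∼ []
      rowᵢ = ∼-trans (≋⇒∼ (≋-sym (∑-last (suc m) (λ j → ev (N (inject₁ i) j) *ₚ v j)))) (sol (inject₁ i))
      rowₗ : S₂ +ₚ a *ₚ v last ∼ []
      rowₗ = ∼-trans (≋⇒∼ (≋-sym (∑-last (suc m) (λ j → ev (N last j) *ₚ v j)))) (sol last)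

  eliminate : ∀ m k (N : Matrix (suc m)) v → MonicSystem (suc k) (suc m) N → Solves (suc m) N v →
              Σ ℕ λ K → Σ Poly λ g → MonicOfDegree K g × (evalAt g P *ₚ v zero ∼ [])
  eliminate zero    k N v (diag , off) sol =
    suc k , N zero zero , diag zero , ∼-trans (≋⇒∼ (≋-sym (+-identityʳ _))) (sol zero)
  eliminate (suc m) k N v mon sol =
    eliminate m (k +ℕ suc k) reduced (v ∘ inject₁) (reduced-monic k mon) (reduced-solves v sol)
    where open Pivot N

δ : ∀ {n} → Fin n → Fin n → ℤ
δ zero    zero    = 1ℤ
δ zero    (suc j) = 0ℤ
δ (suc i) zero    = 0ℤ
δ (suc i) (suc j) = δ i j

0*-zero : ∀ w → const 0ℤ *ₚ w ≋ []
0*-zero w = ≋-trans (*-congˡ w (zero∷ ≋-refl)) ≋-refl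

∑-δ : ∀ n (i : Fin n) (w : Fin n → Poly) → ∑ n (λ j → const (δ i j) *ₚ w j) ≋ w i
∑-δ (suc n) zero    w = ≋-trans (+-cong (*-identityˡ (w zero)) (∑-zero n (0*-zero ∘ w ∘ suc)))
                                (+-identityʳ (w zero))
∑-δ (suc n) (suc i) w = +-cong (0*-zero (w zero)) (∑-δ n i (w ∘ suc))

-- The matrix x·I, defined by recursion on the indices so that its
-- entries stay symbolic; unfolding them inside sums makes type checking
-- prohibitively expensive.
xI : ∀ {n} → Fin n → Fin n → Poly
xI zero    zero    = X
xI zero    (suc j) = []
xI (suc i) zero    = []
xI (suc i) (suc j) = xI i j

xI-diag : ∀ {n} (i : Fin n) → xI i i ≡ X
xI-diag zero    = refl
xI-diag (suc i) = xI-diag i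

xI-off : ∀ {n} (i j : Fin n) → i ≢ j → xI i j ≡ []
xI-off zero    zero    i≢j = ⊥-elim (i≢j refl)
xI-off zero    (suc j) i≢j = refl
xI-off (suc i) zero    i≢j = refl
xI-off (suc i) (suc j) i≢j = xI-off i j (i≢j ∘ cong suc)

∑-xI : ∀ n (i : Fin n) p (w : Fin n → Poly) → ∑ n (λ j → evalAt (xI i j) p *ₚ w j) ≋ p *ₚ w i
∑-xI (suc n) zero    p w = ≋-trans (+-cong (*-congˡ (w zero) (evalAt-X p)) (∑-zero n (λ j → ≋-refl)))
                                   (+-identityʳ (p *ₚ w zero))
∑-xI (suc n) (suc i) p w = ∑-xI n i p (w ∘ suc)

evalAt-entry : ∀ y c p v → evalAt (y -ₚ const c) p *ₚ v ≋ evalAt y p *ₚ v -ₚ const c *ₚ v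
evalAt-entry y c p v = begin
  evalAt (y -ₚ const c) p *ₚ v             ≈⟨ *-congˡ v (evalAt-+ y (-ₚ const c) p) ⟩
  (evalAt y p +ₚ evalAt (-ₚ const c) p) *ₚ v
    ≈⟨ *-congˡ v (+-cong (≋-refl {evalAt y p}) (≋-trans (evalAt-neg (const c) p) (neg-cong (evalAt-const c p)))) ⟩
  (evalAt y p -ₚ const c) *ₚ v             ≈⟨ distrib (evalAt y p) (const c) v ⟩
  evalAt y p *ₚ v -ₚ const c *ₚ v          ∎
  where
  open ≋-Reasoning
  distrib : ∀ a c v → (a -ₚ c) *ₚ v ≋ a *ₚ v -ₚ c *ₚ v
  distrib = solve-∀ ℤ[x]-solverRing

-- Integral closure of ℤ[γ]: if γ satisfies  γⁿ + r(γ) ≡ 0 (mod f)  with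
-- deg r < n, then the powers 1, γ, …, γⁿ⁻¹ span ℤ[γ] as a ℤ-module
-- modulo f, so multiplication by any P = e(γ) is given by an integer
-- matrix C on them; the determinant trick applied to x·I − C then shows
-- that P is a root of a monic integer polynomial.
module IntegralClosure (f γ : Poly) (d : ℕ) (r : Poly) (deg-r : Deg< r (suc d))
                       (root : Modulo._∼_ f (pow γ (suc d) +ₚ evalAt r γ) []) where
  open Modulo f

  n : ℕ
  n = suc d

  basis : Fin n → Poly
  basis j = pow γ (toℕ j)

  lincomb : (Fin n → ℤ) → Poly
  lincomb c = ∑ n (λ j → const (c j) *ₚ basis j)

  Span : Poly → Set
  Span x = Σ (Fin n → ℤ) λ c → x ∼ lincomb c

  span-resp : ∀ {x y} → x ∼ y → Span y → Span x
  span-resp e (c , y∼) = c , ∼-trans e y∼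

  span-0 : Span []
  span-0 = (λ _ → 0ℤ) , ≋⇒∼ (≋-sym (∑-zero n (0*-zero ∘ basis)))

  span-+ : ∀ {x y} → Span x → Span y → Span (x +ₚ y)
  span-+ (c , x∼) (c' , y∼) = (λ j → c j +ℤ c' j) , ∼-trans (∼-+ x∼ y∼) (≋⇒∼ (≋-sym (begin
    ∑ n (λ j → const (c j +ℤ c' j) *ₚ basis j)
      ≈⟨ ∑-cong n (λ j → *-distribʳ (const (c j)) (const (c' j)) (basis j)) ⟩
    ∑ n (λ j → const (c j) *ₚ basis j +ₚ const (c' j) *ₚ basis j)
      ≈⟨ ∑-+ n (λ j → const (c j) *ₚ basis j) (λ j → const (c' j) *ₚ basis j) ⟩
    lincomb c +ₚ lincomb c' ∎)))
    where open ≋-Reasoning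

  span-scale : ∀ a {x} → Span x → Span (const a *ₚ x)
  span-scale a (c , x∼) = (λ j → a *ℤ c j) , ∼-trans (∼-* (∼-refl {const a}) x∼) (≋⇒∼ (begin
    const a *ₚ lincomb c
      ≈⟨ ∑-*ˡ n (const a) (λ j → const (c j) *ₚ basis j) ⟩
    ∑ n (λ j → const a *ₚ (const (c j) *ₚ basis j))
      ≈⟨ ∑-cong n (λ j → ≋-trans (≋-sym (*-assoc (const a) (const (c j)) (basis j)))
                                 (*-congˡ (basis j) (≋-sym (const-* a (c j))))) ⟩
    lincomb (λ j → a *ℤ c j) ∎))
    where open ≋-Reasoning

  span-∑ : ∀ m (g : Fin m → Poly) → (∀ j → Span (g j)) → Span (∑ m g)
  span-∑ zero    g s = span-0
  span-∑ (suc m) g s = span-+ (s zero) (span-∑ m (g ∘ suc) (s ∘ suc))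

  span-basis : ∀ i → Span (basis i)
  span-basis i = δ i , ≋⇒∼ (≋-sym (∑-δ n i basis))

  evalAt-as-∑ : ∀ m A → Deg< A m → evalAt A γ ≋ ∑ m (λ j → const (coeff A (toℕ j)) *ₚ pow γ (toℕ j))
  evalAt-as-∑ zero    A       dA = evalAt-zero γ (Deg<0 dA)
  evalAt-as-∑ (suc m) []      dA = ≋-sym (∑-zero (suc m) (λ j → 0*-zero (pow γ (toℕ j))))
  evalAt-as-∑ (suc m) (c ∷ A) dA = +-cong (≋-sym (*-identityʳ (const c))) (begin
    γ *ₚ evalAt A γ
      ≈⟨ *-congʳ γ (evalAt-as-∑ m A (Deg<-tail dA)) ⟩
    γ *ₚ ∑ m (λ j → const (coeff A (toℕ j)) *ₚ pow γ (toℕ j))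
      ≈⟨ ∑-*ˡ m γ (λ j → const (coeff A (toℕ j)) *ₚ pow γ (toℕ j)) ⟩
    ∑ m (λ j → γ *ₚ (const (coeff A (toℕ j)) *ₚ pow γ (toℕ j)))
      ≈⟨ ∑-cong m (λ j → swap γ (const (coeff A (toℕ j))) (pow γ (toℕ j))) ⟩
    ∑ m (λ j → const (coeff A (toℕ j)) *ₚ (γ *ₚ pow γ (toℕ j))) ∎)
    where
    open ≋-Reasoning
    swap : ∀ g c p → g *ₚ (c *ₚ p) ≋ c *ₚ (g *ₚ p)
    swap = solve-∀ ℤ[x]-solverRing

  -- γⁿ ≡ −r(γ) lies in the span.
  span-top : Span (pow γ n)
  span-top = span-resp top (span-∑ n (λ j → const (-ℤ coeff r (toℕ j)) *ₚ basis j) (λ j → span-scale (-ℤ coeff r (toℕ j)) (span-basis j)))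
    where
    open ∼-Reasoning
    isolate : ∀ a b → a ≋ (a +ₚ b) +ₚ -ₚ b
    isolate = solve-∀ ℤ[x]-solverRing
    neg-scale : ∀ c w → -ₚ (const c *ₚ w) ≋ const (-ℤ c) *ₚ w
    neg-scale c w = neg-* (const c) w
      where
      neg-* : ∀ C w → -ₚ (C *ₚ w) ≋ (-ₚ C) *ₚ w
      neg-* = solve-∀ ℤ[x]-solverRing
    top : pow γ n ∼ ∑ n (λ j → const (-ℤ coeff r (toℕ j)) *ₚ basis j)
    top = begin
      pow γ n                                 ≈⟨ ≋⇒∼ (isolate (pow γ n) (evalAt r γ)) ⟩
      (pow γ n +ₚ evalAt r γ) +ₚ -ₚ evalAt r γ ≈⟨ ∼-+ root (∼-refl { -ₚ evalAt r γ}) ⟩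
      [] +ₚ -ₚ evalAt r γ                     ≈⟨ ≋⇒∼ (neg-cong (evalAt-as-∑ n r deg-r)) ⟩
      -ₚ ∑ n (λ j → const (coeff r (toℕ j)) *ₚ basis j)
        ≈⟨ ≋⇒∼ (≋-trans (∑-neg n (λ j → const (coeff r (toℕ j)) *ₚ basis j)) (∑-cong n (λ j → neg-scale (coeff r (toℕ j)) (basis j)))) ⟩
      ∑ n (λ j → const (-ℤ coeff r (toℕ j)) *ₚ basis j) ∎

  span-γ*basis : ∀ i → Span (γ *ₚ basis i)
  span-γ*basis i with suc (toℕ i) ℕP.<? n
  ... | yes lt = subst (λ k → Span (pow γ k)) (FinP.toℕ-fromℕ< lt) (span-basis (fromℕ< lt))
  ... | no nlt = subst (λ k → Span (pow γ (suc k))) (sym i≡d) span-top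
    where
    i≡d : toℕ i ≡ d
    i≡d = ℕP.≤-antisym (ℕP.≤-pred (FinP.toℕ<n i)) (ℕP.≤-pred (ℕP.≮⇒≥ nlt))

  span-γ* : ∀ {x} → Span x → Span (γ *ₚ x)
  span-γ* (c , x∼) = span-resp (∼-trans (∼-* (∼-refl {γ}) x∼) (≋⇒∼ distribute))
    (span-∑ n (λ j → const (c j) *ₚ (γ *ₚ basis j)) (λ j → span-scale (c j) (span-γ*basis j)))
    where
    swap : ∀ g c p → g *ₚ (c *ₚ p) ≋ c *ₚ (g *ₚ p)
    swap = solve-∀ ℤ[x]-solverRing
    distribute : γ *ₚ lincomb c ≋ ∑ n (λ j → const (c j) *ₚ (γ *ₚ basis j))
    distribute = ≋-trans (∑-*ˡ n γ (λ j → const (c j) *ₚ basis j)) (∑-cong n (λ j → swap γ (const (c j)) (basis j)))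

  span-evalAt* : ∀ e {x} → Span x → Span (evalAt e γ *ₚ x)
  span-evalAt* []      s = span-0
  span-evalAt* (a ∷ e) {x} s =
    span-resp (≋⇒∼ (*-distribʳ (const a) (γ *ₚ evalAt e γ) x))
              (span-+ (span-scale a s) (span-resp (≋⇒∼ (*-assoc γ (evalAt e γ) x))
                                                  (span-γ* (span-evalAt* e s))))

  module MultiplicationBy (e : Poly) where
    P : Poly
    P = evalAt e γ
    open Elimination f P
    -- (abstract: only the existence of the coefficients matters, and
    -- unfolding their construction is expensive)
    abstract
      multiplication : ∀ i → Span (P *ₚ basis i)
      multiplication i = span-evalAt* e (span-basis i)

    C : Fin n → Fin n → ℤ
    C i = proj₁ (multiplication i)
    N : Matrix n
    N i j = xI i j -ₚ const (C i j)

    diag : ∀ i → MonicOfDegree 1 (N i i)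
    diag i = subst (λ y → MonicOfDegree 1 (y -ₚ const (C i i))) (sym (xI-diag i))
                   (-ₚ const (C i i) , ≋-refl , Deg<-neg (Deg<-const (C i i)))

    off : ∀ i j → i ≢ j → Deg< (N i j) 1
    off i j i≢j = subst (λ y → Deg< (y -ₚ const (C i j)) 1) (sym (xI-off i j i≢j))
                        (Deg<-neg (Deg<-const (C i j)))

    solves : Solves n N basis
    solves i = begin
      ∑ n (λ j → evalAt (N i j) P *ₚ basis j)
        ≈⟨ ≋⇒∼ (∑-cong n (λ j → evalAt-entry (xI i j) (C i j) P (basis j))) ⟩
      ∑ n (λ j → evalAt (xI i j) P *ₚ basis j -ₚ const (C i j) *ₚ basis j)
        ≈⟨ ≋⇒∼ (≋-trans (∑-+ n (λ j → evalAt (xI i j) P *ₚ basis j) (λ j → -ₚ (const (C i j) *ₚ basis j)))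
                        (+-cong (∑-xI n i P basis) (≋-sym (∑-neg n (λ j → const (C i j) *ₚ basis j))))) ⟩
      P *ₚ basis i -ₚ lincomb (C i)
        ≈⟨ ∼-+ (proj₂ (multiplication i)) (∼-refl { -ₚ lincomb (C i)}) ⟩
      lincomb (C i) -ₚ lincomb (C i)
        ≈⟨ ≋⇒∼ (+-inverseʳ (lincomb (C i))) ⟩
      [] ∎
      where
      open ∼-Reasoning

    annihilator : Σ ℕ λ K → Σ Poly λ g → MonicOfDegree K g × (evalAt g P *ₚ const 1ℤ ∼ [])
    annihilator = eliminate d 0 N basis (diag , off) solves

  integral : ∀ e → Σ Poly λ g → Monic g × (evalAt g (evalAt e γ) ∼ [])
  integral e with MultiplicationBy.annihilator e
  ... | K , g , monic , g[P]∼0 with MonicOfDegree⇒Monic K monic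
  ... | g' , monic' , g'≋g = g' , monic' ,
    ∼-trans (≋⇒∼ (≋-trans (evalAt-congˡ (evalAt e γ) g'≋g) (≋-sym (*-identityʳ (evalAt g (evalAt e γ)))))) g[P]∼0

coeff₀-* : ∀ p q → coeff (p *ₚ q) 0 ≡ coeff p 0 *ℤ coeff q 0
coeff₀-* []      q = refl
coeff₀-* (c ∷ p) q = trans (coeff-+ (c ·ₚ q) (0ℤ ∷ (p *ₚ q)) 0) (trans (ℤP.+-identityʳ _) (coeff-· c q 0))

X*-shift : ∀ y → X *ₚ y ≋ 0ℤ ∷ y
X*-shift y = +-cong (0·-zero y) (∷-cong refl (*-identityˡ y))

tail : Poly → Poly
tail []      = []
tail (c ∷ w) = w

X*tail : ∀ w → coeff w 0 ≡ 0ℤ → w ≋ X *ₚ tail w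
X*tail []      e = ≋-sym (≋-trans (X*-shift []) (zero∷ ≋-refl))
X*tail (c ∷ w) e = ≋-trans (∷-cong e ≋-refl) (≋-sym (X*-shift w))

coeff₀-X* : ∀ y → coeff (X *ₚ y) 0 ≡ 0ℤ
coeff₀-X* y = at (X*-shift y) 0

module MinimalPolynomial (f : Poly) (minimal : IsMinimalPoly f) (α≢0 : ¬ (X ≡[ f ] [])) where
  open Modulo f

  a₀ : ℤ
  a₀ = coeff f 0

  f≉0 : ¬ (f ≋ [])
  f≉0 e = proj₁ minimal (0ℤ , ≋⇒≈ₚ (≋-trans e (≋-sym (zero∷ ≋-refl))))

  -- x is not a unit: its linear coefficient is 1, that of ±1 is 0.
  1≢0 : ¬ (1ℤ ≡ 0ℤ)
  1≢0 ()

  -- If f(0) = 0 then x ∣ f, and irreducibility forces f = ±x, i.e. α = 0.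
  a₀≢0 : a₀ ≢ 0ℤ
  a₀≢0 a₀≡0 with proj₂ minimal X (tail f) (≋⇒≈ₚ (X*tail f a₀≡0))
  ... | inj₁ (inj₁ X≈1)       = 1≢0 (at (≈ₚ⇒≋ {X} {const 1ℤ} X≈1) 1)
  ... | inj₁ (inj₂ X≈-1)      = 1≢0 (at (≈ₚ⇒≋ {X} {const -1ℤ} X≈-1) 1)
  ... | inj₂ (inj₁ tail≈1)    = α≢0 (∼⇒≡[f] {X} {[]} (mk∼ (const 1ℤ) (≋-sym (begin
    [] +ₚ const 1ℤ *ₚ f         ≈⟨ *-identityˡ f ⟩
    f                           ≈⟨ X*tail f a₀≡0 ⟩
    X *ₚ tail f                 ≈⟨ *-congʳ X (≈ₚ⇒≋ {tail f} {const 1ℤ} tail≈1) ⟩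
    X *ₚ const 1ℤ               ≈⟨ *-identityʳ X ⟩
    X                           ∎))))
    where open ≋-Reasoning
  ... | inj₂ (inj₂ tail≈-1)   = α≢0 (∼⇒≡[f] {X} {[]} (mk∼ (const -1ℤ) (≋-sym (begin
    [] +ₚ const -1ℤ *ₚ f        ≈⟨ +-cong (≋-refl {[]}) (*-congʳ (const -1ℤ) (X*tail f a₀≡0)) ⟩
    [] +ₚ const -1ℤ *ₚ (X *ₚ tail f)
                                ≈⟨ +-cong (≋-refl {[]}) (*-congʳ (const -1ℤ) (*-congʳ X (≈ₚ⇒≋ {tail f} {const -1ℤ} tail≈-1))) ⟩
    [] +ₚ const -1ℤ *ₚ (X *ₚ const -1ℤ)
                                ≈⟨ ≋i (λ { zero → refl ; (suc zero) → refl ; (suc (suc i)) → refl }) ⟩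
    X                           ∎))))
    where open ≋-Reasoning

  -- α is not a zero divisor in ℤ[α]: from x z = h f, comparing constant
  -- terms gives h(0) a₀ = 0, so x ∣ h and z = (h / x) f.
  α-cancel : ∀ z → X *ₚ z ∼ [] → z ∼ []
  α-cancel z (mk∼ h e) = mk∼ (tail h) (∷-tail (begin
    0ℤ ∷ z                      ≈⟨ X*-shift z ⟨
    X *ₚ z                      ≈⟨ e ⟩
    h *ₚ f                      ≈⟨ *-congˡ f (X*tail h h₀≡0) ⟩
    (X *ₚ tail h) *ₚ f          ≈⟨ *-assoc X (tail h) f ⟩
    X *ₚ (tail h *ₚ f)          ≈⟨ X*-shift (tail h *ₚ f) ⟩
    0ℤ ∷ (tail h *ₚ f)          ∎))
    where
    open ≋-Reasoning
    h₀a₀≡0 : coeff h 0 *ℤ a₀ ≡ 0ℤ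
    h₀a₀≡0 = trans (sym (coeff₀-* h f)) (trans (sym (at e 0)) (coeff₀-X* z))
    h₀≡0 : coeff h 0 ≡ 0ℤ
    h₀≡0 with ℤP.i*j≡0⇒i≡0∨j≡0 (coeff h 0) h₀a₀≡0
    ... | inj₁ h₀≡0 = h₀≡0
    ... | inj₂ a₀≡0 = ⊥-elim (a₀≢0 a₀≡0)

  inαIdeal⇒ : ∀ p → InαIdeal f p → Σ ℤ λ k → coeff p 0 ≡ k *ℤ a₀
  inαIdeal⇒ p (γ , p≡αγ) with ≡[f]⇒∼ {p} {X *ₚ γ} p≡αγ
  ... | mk∼ h e = coeff h 0 , (begin
    coeff p 0                               ≡⟨ at e 0 ⟩
    coeff (X *ₚ γ +ₚ h *ₚ f) 0              ≡⟨ coeff-+ (X *ₚ γ) (h *ₚ f) 0 ⟩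
    coeff (X *ₚ γ) 0 +ℤ coeff (h *ₚ f) 0    ≡⟨ cong₂ _+ℤ_ (coeff₀-X* γ) (coeff₀-* h f) ⟩
    0ℤ +ℤ coeff h 0 *ℤ a₀                   ≡⟨ ℤP.+-identityˡ _ ⟩
    coeff h 0 *ℤ a₀                         ∎)
    where open ≡-Reasoning

  ⇒inαIdeal : ∀ p k → coeff p 0 ≡ k *ℤ a₀ → InαIdeal f p
  ⇒inαIdeal p k p₀≡ka₀ = tail w , ∼⇒≡[f] {p} {X *ₚ tail w} (mk∼ (const k) (begin
    p                                ≈⟨ split p (const k *ₚ f) ⟩
    w +ₚ const k *ₚ f                ≈⟨ +-cong (X*tail w w₀≡0) ≋-refl ⟩
    X *ₚ tail w +ₚ const k *ₚ f      ∎))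
    where
    open ≋-Reasoning
    w : Poly
    w = p -ₚ const k *ₚ f
    split : ∀ p u → p ≋ (p -ₚ u) +ₚ u
    split = solve-∀ ℤ[x]-solverRing
    w₀≡0 : coeff w 0 ≡ 0ℤ
    w₀≡0 = trans (coeff-+ p (-ₚ (const k *ₚ f)) 0)
           (trans (cong₂ _+ℤ_ p₀≡ka₀ (trans (coeff-neg (const k *ₚ f) 0) (cong -ℤ_ (coeff₀-* (const k) f))))
                  (ℤP.+-inverseʳ (k *ℤ a₀)))

∷≋ : ∀ x h → (x ∷ h) ≋ const x +ₚ X *ₚ h
∷≋ x h = ≋-sym (≋-trans (+-cong (≋-refl {const x}) (X*-shift h)) (∷-cong (ℤP.+-identityʳ x) ≋-refl))

-- Rescaling by an integer c.  For γ = c·α and deg h ≤ k we have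
-- cᵏ h(α) = h̃(γ), where h̃ = rescale k h has coefficients hᵢ cᵏ⁻ⁱ; so
-- cᵏ h(α) ∈ ℤ[γ].
module Rescaling (c : ℤ) where

  γ : Poly
  γ = c ·ₚ X

  rescale : ℕ → Poly → Poly
  rescale k       []      = []
  rescale zero    (x ∷ h) = const x
  rescale (suc k) (x ∷ h) = (x *ℤ c ^ suc k) ∷ rescale k h

  Deg<-rescale : ∀ k h → Deg< (rescale k h) (suc k)
  Deg<-rescale k       []      = Deg<-[]
  Deg<-rescale zero    (x ∷ h) = Deg<-const x
  Deg<-rescale (suc k) (x ∷ h) = Deg<-∷ (Deg<-rescale k h)

  evalAt-rescale : ∀ k h → Deg< h (suc k) → evalAt (rescale k h) γ ≋ const (c ^ k) *ₚ h
  evalAt-rescale k       []      dh = ≋-sym (*-zeroʳ (const (c ^ k)))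
  evalAt-rescale zero    (x ∷ h) dh = begin
    evalAt (const x) γ    ≈⟨ evalAt-const x γ ⟩
    const x               ≈⟨ ∷-cong refl (≋-sym (Deg<0 (Deg<-tail dh))) ⟩
    x ∷ h                 ≈⟨ *-identityˡ (x ∷ h) ⟨
    const 1ℤ *ₚ (x ∷ h)   ∎
    where open ≋-Reasoning
  evalAt-rescale (suc k) (x ∷ h) dh = begin
    const (x *ℤ c ^ suc k) +ₚ γ *ₚ evalAt (rescale k h) γ
      ≈⟨ +-cong (≋-trans (const-* x (c ^ suc k)) (*-congʳ (const x) (const-* c (c ^ k))))
                (≋-trans (*-congˡ (evalAt (rescale k h) γ) (·≋const* c X)) (*-congʳ (const c *ₚ X) (evalAt-rescale k h (Deg<-tail dh)))) ⟩
    const x *ₚ (const c *ₚ const (c ^ k)) +ₚ (const c *ₚ X) *ₚ (const (c ^ k) *ₚ h)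
      ≈⟨ factor (const x) (const c) (const (c ^ k)) h ⟩
    (const c *ₚ const (c ^ k)) *ₚ (const x +ₚ X *ₚ h)
      ≈⟨ ≋-trans (*-congˡ (x ∷ h) (const-* c (c ^ k))) (*-congʳ (const c *ₚ const (c ^ k)) (∷≋ x h)) ⟨
    const (c ^ suc k) *ₚ (x ∷ h) ∎
    where
    open ≋-Reasoning
    factor : ∀ x c p h → x *ₚ (c *ₚ p) +ₚ (c *ₚ X) *ₚ (p *ₚ h) ≋ (c *ₚ p) *ₚ (x +ₚ X *ₚ h)
    factor = solve-∀ ℤ[x]-solverRing

  pow-γ : ∀ m → pow γ m ≋ const (c ^ m) *ₚ Xp m
  pow-γ zero    = ≋-sym (*-identityˡ (Xp 0))
  pow-γ (suc m) = begin
    γ *ₚ pow γ m                               ≈⟨ ≋-trans (*-congˡ (pow γ m) (·≋const* c X)) (*-congʳ (const c *ₚ X) (pow-γ m)) ⟩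
    (const c *ₚ X) *ₚ (const (c ^ m) *ₚ Xp m)  ≈⟨ regroup (const c) X (const (c ^ m)) (Xp m) ⟩
    (const c *ₚ const (c ^ m)) *ₚ (X *ₚ Xp m)  ≈⟨ *-cong (≋-sym (const-* c (c ^ m))) (Xp-* 1 m) ⟩
    const (c ^ suc m) *ₚ Xp (suc m)            ∎
    where
    open ≋-Reasoning
    regroup : ∀ c x p q → (c *ₚ x) *ₚ (p *ₚ q) ≋ (c *ₚ p) *ₚ (x *ₚ q)
    regroup = solve-∀ ℤ[x]-solverRing
    *-cong : ∀ {p p' q q'} → p ≋ p' → q ≋ q' → p *ₚ q ≋ p' *ₚ q'
    *-cong {p} {p'} {q} e e' = ≋-trans (*-congˡ q e) (*-congʳ p' e')

  -- If f = a xᵈ⁺¹ + f' (deg f' ≤ d) and c = s a, then γ = c α is a root of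
  -- the monic polynomial  xᵈ⁺¹ + s·rescale d f':  indeed
  -- γᵈ⁺¹ + s cᵈ f'(α) = s cᵈ (a αᵈ⁺¹ + f'(α)) = s cᵈ f(α) = 0.
  γ-root : ∀ f d a f' s → f ≋ f' +ₚ Xp (suc d) *ₚ const a → Deg< f' (suc d) → s *ℤ a ≡ c →
           Modulo._∼_ f (pow γ (suc d) +ₚ evalAt (s ·ₚ rescale d f') γ) []
  γ-root f d a f' s f≋ deg-f' sa≡c = Modulo.mk∼ (const s *ₚ const (c ^ d)) (begin
    pow γ (suc d) +ₚ evalAt (s ·ₚ rescale d f') γ
      ≈⟨ +-cong (pow-γ (suc d)) (≋-trans (evalAt-· s (rescale d f') γ)
                                         (*-congʳ (const s) (evalAt-rescale d f' deg-f'))) ⟩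
    const (c ^ suc d) *ₚ Xp (suc d) +ₚ const s *ₚ (const (c ^ d) *ₚ f')
      ≈⟨ +-cong (*-congˡ (Xp (suc d)) c^d+1≋) (≋-refl {const s *ₚ (const (c ^ d) *ₚ f')}) ⟩
    ((const s *ₚ const a) *ₚ const (c ^ d)) *ₚ Xp (suc d) +ₚ const s *ₚ (const (c ^ d) *ₚ f')
      ≈⟨ factor (const s) (const a) (const (c ^ d)) (Xp (suc d)) f' ⟩
    [] +ₚ (const s *ₚ const (c ^ d)) *ₚ (f' +ₚ Xp (suc d) *ₚ const a)
      ≈⟨ +-cong (≋-refl {[]}) (*-congʳ (const s *ₚ const (c ^ d)) (≋-sym f≋)) ⟩
    [] +ₚ (const s *ₚ const (c ^ d)) *ₚ f ∎)
    where
    open ≋-Reasoning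
    factor : ∀ s a p x f' → ((s *ₚ a) *ₚ p) *ₚ x +ₚ s *ₚ (p *ₚ f') ≋ [] +ₚ (s *ₚ p) *ₚ (f' +ₚ x *ₚ a)
    factor = solve-∀ ℤ[x]-solverRing
    c^d+1≋ : const (c ^ suc d) ≋ (const s *ₚ const a) *ₚ const (c ^ d)
    c^d+1≋ = ≋-trans (const-* c (c ^ d))
             (*-congˡ (const (c ^ d)) (≋-trans (∷-cong (sym sa≡c) ≋-refl) (const-* s a)))

length-+ : ∀ p q → length (p +ₚ q) ≡ length p ⊔ length q
length-+ []      q       = refl
length-+ (a ∷ p) []      = refl
length-+ (a ∷ p) (b ∷ q) = cong suc (length-+ p q)

length-- : ∀ p q → length (p -ₚ q) ≡ length p ⊔ length q
length-- p q = trans (length-+ p (-ₚ q)) (cong (length p ⊔_) (ListP.length-map -ℤ_ q))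

length-tail : ∀ w → length (tail w) ≡ pred (length w)
length-tail []      = refl
length-tail (c ∷ w) = refl

pred-⊔ : ∀ a b → pred (a ⊔ b) ≤ℕ a ⊔ pred b
pred-⊔ zero    b       = ℕP.≤-refl
pred-⊔ (suc a) zero    = ℕP.n≤1+n a
pred-⊔ (suc a) (suc b) = ℕP.⊔-mono-≤ (ℕP.n≤1+n a) (ℕP.≤-refl {b})

module _ (f : Poly) (minimal : IsMinimalPoly f) (α≢0 : ¬ (X ≡[ f ] [])) where
  open Modulo f
  open MinimalPolynomial f minimal α≢0

  -- Exact division by α lowers the length of a representative: if
  -- u ≡ α y then y ≡ q with  length q ≤ max(length u, length f) − 1.
  -- (Write u = α y + h f; then w = u − h(0) f has w(0) = 0 and q = w / x.)
  divide-by-α : ∀ u y → u ∼ X *ₚ y → Σ Poly λ q → (y ∼ q) × (length q ≤ℕ pred (length u ⊔ length f))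
  divide-by-α u y u∼αy@(mk∼ h e) = q , y∼q , length-q
    where
    h₀ : ℤ
    h₀ = coeff h 0
    w q : Poly
    w = u -ₚ h₀ ·ₚ f
    q = tail w
    w₀≡0 : coeff w 0 ≡ 0ℤ
    w₀≡0 = begin
      coeff w 0                                   ≡⟨ coeff-+ u (-ₚ (h₀ ·ₚ f)) 0 ⟩
      coeff u 0 +ℤ coeff (-ₚ (h₀ ·ₚ f)) 0         ≡⟨ cong₂ _+ℤ_ u₀ (trans (coeff-neg (h₀ ·ₚ f) 0) (cong -ℤ_ (coeff-· h₀ f 0))) ⟩
      h₀ *ℤ a₀ +ℤ -ℤ (h₀ *ℤ a₀)                   ≡⟨ ℤP.+-inverseʳ (h₀ *ℤ a₀) ⟩
      0ℤ                                          ∎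
      where
      open ≡-Reasoning
      u₀ : coeff u 0 ≡ h₀ *ℤ a₀
      u₀ = trans (at e 0) (trans (coeff-+ (X *ₚ y) (h *ₚ f) 0)
             (trans (cong₂ _+ℤ_ (coeff₀-X* y) (coeff₀-* h f)) (ℤP.+-identityˡ _)))
    w∼u : w ∼ u
    w∼u = mk∼ (-ₚ const h₀) (≋-trans (+-cong (≋-refl {u}) (neg-cong (·≋const* h₀ f))) (move u (const h₀) f))
      where
      move : ∀ u c f → u -ₚ c *ₚ f ≋ u +ₚ (-ₚ c) *ₚ f
      move = solve-∀ ℤ[x]-solverRing
    α[y-q]∼0 : X *ₚ (y -ₚ q) ∼ []
    α[y-q]∼0 = begin
      X *ₚ (y -ₚ q)               ≈⟨ ≋⇒∼ (distrib X y q) ⟩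
      X *ₚ y -ₚ X *ₚ q            ≈⟨ ∼-+ (∼-refl {X *ₚ y}) (∼-neg (∼-trans (≋⇒∼ (≋-sym (X*tail w w₀≡0))) w∼u)) ⟩
      X *ₚ y -ₚ u                 ≈⟨ ∼-+ (∼-refl {X *ₚ y}) (∼-neg u∼αy) ⟩
      X *ₚ y -ₚ X *ₚ y            ≈⟨ ≋⇒∼ (+-inverseʳ (X *ₚ y)) ⟩
      []                          ∎
      where
      open ∼-Reasoning
      distrib : ∀ x y q → x *ₚ (y -ₚ q) ≋ x *ₚ y -ₚ x *ₚ q
      distrib = solve-∀ ℤ[x]-solverRing
    y∼q : y ∼ q
    y∼q = begin
      y                 ≈⟨ ≋⇒∼ (split y q) ⟩
      (y -ₚ q) +ₚ q     ≈⟨ ∼-+ (α-cancel (y -ₚ q) α[y-q]∼0) (∼-refl {q}) ⟩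
      [] +ₚ q           ∎
      where
      open ∼-Reasoning
      split : ∀ y q → y ≋ (y -ₚ q) +ₚ q
      split = solve-∀ ℤ[x]-solverRing
    length-q : length q ≤ℕ pred (length u ⊔ length f)
    length-q = ℕP.≤-reflexive (trans (length-tail w)
                 (cong pred (trans (length-- u (h₀ ·ₚ f)) (cong (length u ⊔_) (ListP.length-map (h₀ *ℤ_) f)))))

  -- R has only |a₀| classes: r ∈ R is congruent to the chosen element
  -- of R in the class of the constant r(0) mod a₀.
  module Residues (R : Poly → Set) (complete : IsCompleteResidueSystem f R) where

    instance
      a₀-nonZero : ℤ.NonZero a₀
      a₀-nonZero = ℤ.≢-nonZero a₀≢0

    representative : ℕ → Poly
    representative c = proj₁ (proj₁ complete (const (+ c)))

    representative∈R : ∀ c → R (representative c)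
    representative∈R c = proj₁ (proj₂ (proj₁ complete (const (+ c))))

    class : Poly → ℕ
    class r = coeff r 0 % a₀

    R⇒representative : ∀ r → R r → r ∼ representative (class r)
    R⇒representative r r∈R = ≡[f]⇒∼ (proj₂ complete r ρ r∈R (representative∈R c) (⇒inαIdeal (r -ₚ ρ) k r₀-ρ₀))
      where
      c : ℕ
      c = class r
      ρ : Poly
      ρ = representative c
      c-ρ∈αℤ[α] : Σ ℤ λ k₁ → coeff (const (+ c) -ₚ ρ) 0 ≡ k₁ *ℤ a₀
      c-ρ∈αℤ[α] = inαIdeal⇒ (const (+ c) -ₚ ρ) (proj₂ (proj₂ (proj₁ complete (const (+ c)))))
      k₁ k : ℤ
      k₁ = proj₁ c-ρ∈αℤ[α]
      k = coeff r 0 / a₀ +ℤ k₁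
      coeff₀-- : ∀ p q → coeff (p -ₚ q) 0 ≡ coeff p 0 +ℤ -ℤ coeff q 0
      coeff₀-- p q = trans (coeff-+ p (-ₚ q) 0) (cong (coeff p 0 +ℤ_) (coeff-neg q 0))
      regroup : ∀ c q a ρ₀ → (c +ℤ q *ℤ a) +ℤ -ℤ ρ₀ ≡ q *ℤ a +ℤ (c +ℤ -ℤ ρ₀)
      regroup = ℤ-Solver.solve-∀
      r₀-ρ₀ : coeff (r -ₚ ρ) 0 ≡ k *ℤ a₀
      r₀-ρ₀ = begin
        coeff (r -ₚ ρ) 0                             ≡⟨ coeff₀-- r ρ ⟩
        coeff r 0 +ℤ -ℤ coeff ρ 0                    ≡⟨ cong (_+ℤ -ℤ coeff ρ 0) (a≡a%n+[a/n]*n (coeff r 0) a₀) ⟩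
        (+ c +ℤ (coeff r 0 / a₀) *ℤ a₀) +ℤ -ℤ coeff ρ 0 ≡⟨ regroup (+ c) (coeff r 0 / a₀) a₀ (coeff ρ 0) ⟩
        (coeff r 0 / a₀) *ℤ a₀ +ℤ (+ c +ℤ -ℤ coeff ρ 0) ≡⟨ cong ((coeff r 0 / a₀) *ℤ a₀ +ℤ_) (trans (sym (coeff₀-- (const (+ c)) ρ)) (proj₂ c-ρ∈αℤ[α])) ⟩
        (coeff r 0 / a₀) *ℤ a₀ +ℤ k₁ *ℤ a₀           ≡⟨ ℤP.*-distribʳ-+ a₀ (coeff r 0 / a₀) k₁ ⟨
        k *ℤ a₀                                      ∎
        where open ≡-Reasoning

    maxLength : ℕ → ℕ
    maxLength zero    = 0
    maxLength (suc c) = length (representative c) ⊔ maxLength c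

    ≤-maxLength : ∀ c m → c <ℕ m → length (representative c) ≤ℕ maxLength m
    ≤-maxLength c (suc m) c<1+m with ℕP.m≤n⇒m<n∨m≡n (ℕP.≤-pred c<1+m)
    ... | inj₁ c<m  = ℕP.≤-trans (≤-maxLength c m c<m) (ℕP.m≤n⊔m (length (representative m)) (maxLength m))
    ... | inj₂ refl = ℕP.m≤m⊔n (length (representative c)) (maxLength c)

    D : ℕ
    D = maxLength ∣ a₀ ∣

    R-bounded : ∀ r → R r → Σ Poly λ ρ → (r ∼ ρ) × (length ρ ≤ℕ D)
    R-bounded r r∈R = representative (class r) , R⇒representative r r∈R ,
                      ≤-maxLength (class r) ∣ a₀ ∣ (n%d<d (coeff r 0) a₀)

abs-as-multiple : ∀ a → Σ ℤ λ s → s *ℤ a ≡ + ∣ a ∣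
abs-as-multiple a with ℤP.+∣i∣≡i⊎+∣i∣≡-i a
... | inj₁ |a|≡a  = 1ℤ , trans (ℤP.*-identityˡ a) (sym |a|≡a)
... | inj₂ |a|≡-a = -1ℤ , trans (ℤP.-1*i≡-i a) (sym |a|≡-a)

pos-^ : ∀ m k → + (m ^ℕ k) ≡ (+ m) ^ k
pos-^ m zero    = refl
pos-^ m (suc k) = trans (ℤP.pos-* m (m ^ℕ k)) (cong (+ m *ℤ_) (pos-^ m k))

-- The iterates of J have representatives of bounded length: each step
-- J(β) = (β − r)/α with r ∈ R shortens a representative of β unless it is
-- already no longer than E = max(D, length f).
module Descent (f : Poly) (minimal : IsMinimalPoly f) (α≢0 : ¬ (X ≡[ f ] []))
               (R : Poly → Set) (complete : IsCompleteResidueSystem f R)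
               (J : Poly → Poly) (isJ : IsJMap f R J) where
  open Modulo f
  open Residues f minimal α≢0 R complete

  E : ℕ
  E = D ⊔ length f

  digit-step : ∀ β b m r y → β ∼ b → length b ≤ℕ E ⊔ m → R r → β ∼ r +ₚ X *ₚ y →
               Σ Poly λ q → (y ∼ q) × (length q ≤ℕ E ⊔ pred m)
  digit-step β b m r y β∼b length-b r∈R β∼r+αy = q , y∼q , length-q′
    where
    ρ : Poly
    ρ = proj₁ (R-bounded r r∈R)
    r∼ρ : r ∼ ρ
    r∼ρ = proj₁ (proj₂ (R-bounded r r∈R))
    length-ρ : length ρ ≤ℕ D
    length-ρ = proj₂ (proj₂ (R-bounded r r∈R))
    b-ρ∼αy : b -ₚ ρ ∼ X *ₚ y
    b-ρ∼αy = begin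
      b -ₚ ρ                         ≈⟨ ∼-+ (∼-sym β∼b) (∼-neg (∼-sym r∼ρ)) ⟩
      β -ₚ r                         ≈⟨ ∼-+ β∼r+αy (∼-refl { -ₚ r}) ⟩
      (r +ₚ X *ₚ y) -ₚ r             ≈⟨ ≋⇒∼ (cancel r (X *ₚ y)) ⟩
      X *ₚ y                         ∎
      where
      open ∼-Reasoning
      cancel : ∀ r z → (r +ₚ z) -ₚ r ≋ z
      cancel = solve-∀ ℤ[x]-solverRing
    division : Σ Poly λ q → (y ∼ q) × (length q ≤ℕ pred (length (b -ₚ ρ) ⊔ length f))
    division = divide-by-α f minimal α≢0 (b -ₚ ρ) y b-ρ∼αy
    q : Poly
    q = proj₁ division
    y∼q : y ∼ q
    y∼q = proj₁ (proj₂ division)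
    length-q′ : length q ≤ℕ E ⊔ pred m
    length-q′ = begin
      length q                                       ≤⟨ proj₂ (proj₂ division) ⟩
      pred (length (b -ₚ ρ) ⊔ length f)              ≡⟨ cong (λ l → pred (l ⊔ length f)) (length-- b ρ) ⟩
      pred ((length b ⊔ length ρ) ⊔ length f)        ≤⟨ ℕP.pred-mono-≤ (ℕP.⊔-lub (ℕP.⊔-lub length-b ρ-bound) f-bound) ⟩
      pred (E ⊔ m)                                   ≤⟨ pred-⊔ E m ⟩
      E ⊔ pred m                                     ∎
      where
      open ℕP.≤-Reasoning
      ρ-bound : length ρ ≤ℕ E ⊔ m
      ρ-bound = ℕP.≤-trans length-ρ (ℕP.≤-trans (ℕP.m≤m⊔n D (length f)) (ℕP.m≤m⊔n E m))
      f-bound : length f ≤ℕ E ⊔ m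
      f-bound = ℕP.≤-trans (ℕP.m≤n⊔m D (length f)) (ℕP.m≤m⊔n E m)

  J-step : ∀ β b m → β ∼ b → length b ≤ℕ E ⊔ m → Σ Poly λ q → (J β ∼ q) × (length q ≤ℕ E ⊔ pred m)
  J-step β b m β∼b length-b = step (isJ β)
    where
    step : (Σ Poly λ r → R r × (β ≡[ f ] (r +ₚ X *ₚ J β))) →
           Σ Poly λ q → (J β ∼ q) × (length q ≤ℕ E ⊔ pred m)
    step (r , r∈R , β≡r+αJβ) =
      digit-step β b m r (J β) β∼b length-b r∈R (≡[f]⇒∼ {β} {r +ₚ X *ₚ J β} β≡r+αJβ)

  iterate-bound : ∀ β n → Σ Poly λ q → (iter J n β ∼ q) × (length q ≤ℕ E ⊔ (length β ∸ n))
  iterate-bound β zero    = β , ∼-refl , ℕP.m≤n⊔m E (length β)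
  iterate-bound β (suc n) = extend (iterate-bound β n)
    where
    extend : (Σ Poly λ b → (iter J n β ∼ b) × (length b ≤ℕ E ⊔ (length β ∸ n))) →
             Σ Poly λ q → (iter J (suc n) β ∼ q) × (length q ≤ℕ E ⊔ (length β ∸ suc n))
    extend (b , Jⁿβ∼b , length-b) =
      q , proj₁ (proj₂ step) ,
      subst (λ l → length q ≤ℕ E ⊔ l) (ℕP.pred[m∸n]≡m∸[1+n] (length β) n) (proj₂ (proj₂ step))
      where
      step : Σ Poly λ q → (J (iter J n β) ∼ q) × (length q ≤ℕ E ⊔ pred (length β ∸ n))
      step = J-step (iter J n β) b (length β ∸ n) Jⁿβ∼b length-b
      q : Poly
      q = proj₁ step

EventuallyIntegral : Poly → (Poly → Poly) → Set
EventuallyIntegral f J =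
  Σ ℕ λ L → (L > 0) × (∀ β → Σ ℕ λ c → ∀ n → c ≤ℕ n → IsAlgInt f ((+ L) ·ₚ iter J n β))

-- With f = a xᵈ⁺¹ + f' (a ≠ 0) and c = |a|: after length β steps the
-- iterate Jⁿ(β) has a representative q of length ≤ E, so
-- |a|ᴱ Jⁿ(β) = cᴱ q(α) = (rescale E q)(γ) lies in ℤ[γ], γ = c α, which is
-- integral over ℤ.
module Conclusion (f : Poly) (minimal : IsMinimalPoly f) (α≢0 : ¬ (X ≡[ f ] []))
                  (R : Poly → Set) (complete : IsCompleteResidueSystem f R)
                  (J : Poly → Poly) (isJ : IsJMap f R J)
                  (d : ℕ) (a : ℤ) (f' : Poly) (a≢0 : a ≢ 0ℤ)
                  (deg-f' : Deg< f' (suc d)) (f≋ : f ≋ f' +ₚ Xp (suc d) *ₚ const a) where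
  open Modulo f
  open Descent f minimal α≢0 R complete J isJ

  A : ℕ
  A = ∣ a ∣

  instance
    A-nonZero : NonZero A
    A-nonZero = ≢-nonZero (λ |a|≡0 → a≢0 (ℤP.∣i∣≡0⇒i≡0 |a|≡0))

  s : ℤ
  s = proj₁ (abs-as-multiple a)

  open Rescaling (+ A)

  module γ-integral = IntegralClosure f γ d (s ·ₚ rescale d f') (Deg<-· s (Deg<-rescale d f'))
                                      (γ-root f d a f' s f≋ deg-f' (proj₂ (abs-as-multiple a)))

  L : ℕ
  L = A ^ℕ E

  L>0 : L > 0
  L>0 = ℕP.m^n>0 A E

  eventually-integral : ∀ β n → length β ≤ℕ n → IsAlgInt f ((+ L) ·ₚ iter J n β)
  eventually-integral β n n≥ = g , monic , ∼⇒≡[f] (∼-trans (evalAt-congʳ f g LJⁿβ∼) g-root)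
    where
    bound : Σ Poly λ q → (iter J n β ∼ q) × (length q ≤ℕ E ⊔ (length β ∸ n))
    bound = iterate-bound β n
    q : Poly
    q = proj₁ bound
    deg-q : Deg< q (suc E)
    deg-q = Deg<-mono (ℕP.≤-trans length-q≤E (ℕP.n≤1+n E)) (Deg<-length q)
      where
      length-q≤E : length q ≤ℕ E
      length-q≤E = subst (length q ≤ℕ_) (ℕP.⊔-identityʳ E)
                     (subst (λ l → length q ≤ℕ E ⊔ l) (ℕP.m≤n⇒m∸n≡0 n≥) (proj₂ (proj₂ bound)))
    LJⁿβ∼ : (+ L) ·ₚ iter J n β ∼ evalAt (rescale E q) γ
    LJⁿβ∼ = begin
      (+ L) ·ₚ iter J n β            ≈⟨ ≋⇒∼ (·≋const* (+ L) (iter J n β)) ⟩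
      const (+ L) *ₚ iter J n β      ≈⟨ ∼-* (∼-refl {const (+ L)}) (proj₁ (proj₂ bound)) ⟩
      const (+ L) *ₚ q               ≈⟨ ≋⇒∼ (subst (λ z → const (+ L) *ₚ q ≋ const z *ₚ q) (pos-^ A E) ≋-refl) ⟩
      const ((+ A) ^ E) *ₚ q         ≈⟨ ≋⇒∼ (≋-sym (evalAt-rescale E q deg-q)) ⟩
      evalAt (rescale E q) γ         ∎
      where open ∼-Reasoning
    integral : Σ Poly λ g → Monic g × (evalAt g (evalAt (rescale E q) γ) ∼ [])
    integral = γ-integral.integral (rescale E q)
    g : Poly
    g = proj₁ integral
    monic : Monic g
    monic = proj₁ (proj₂ integral)
    g-root : evalAt g (evalAt (rescale E q) γ) ∼ []
    g-root = proj₂ (proj₂ integral)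

  result : EventuallyIntegral f J
  result = L , L>0 , λ β → length β , eventually-integral β

minimal-leading-term : ∀ f → IsMinimalPoly f → ¬ (X ≡[ f ] []) →
  Σ ℕ λ d → Σ ℤ λ a → Σ Poly λ f' → (a ≢ 0ℤ) × Deg< f' (suc d) × (f ≋ f' +ₚ Xp (suc d) *ₚ const a)
minimal-leading-term f minimal α≢0 = from (leading-term f)
  where
  open MinimalPolynomial f minimal α≢0
  from : (f ≋ []) ⊎ (Σ ℕ λ d → Σ ℤ λ a → Σ Poly λ f' → (a ≢ 0ℤ) × Deg< f' d × (f ≋ f' +ₚ Xp d *ₚ const a)) →
         Σ ℕ λ d → Σ ℤ λ a → Σ Poly λ f' → (a ≢ 0ℤ) × Deg< f' (suc d) × (f ≋ f' +ₚ Xp (suc d) *ₚ const a)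
  from (inj₁ f≋0) = ⊥-elim (f≉0 f≋0)
  from (inj₂ (zero  , a , f' , a≢0 , deg-f' , f≋)) =
    ⊥-elim (proj₁ minimal (a , ≋⇒≈ₚ (≋-trans f≋ (+-cong (Deg<0 deg-f') (*-identityˡ (const a))))))
  from (inj₂ (suc d , a , f' , a≢0 , deg-f' , f≋)) = d , a , f' , a≢0 , deg-f' , f≋

proposition2 : (f : Poly) → IsMinimalPoly f → ¬ (X ≡[ f ] []) →
    (R : Poly → Set) → IsCompleteResidueSystem f R →
    (J : Poly → Poly) → IsJMap f R J →
    Σ ℕ λ L → (L > 0) ×
    (∀ β → Σ ℕ λ c → ∀ n → c ≤ℕ n → IsAlgInt f ((+ L) ·ₚ iter J n β))
proposition2 f minimal α≢0 R complete J isJ = conclude (minimal-leading-term f minimal α≢0)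
  where
  conclude : (Σ ℕ λ d → Σ ℤ λ a → Σ Poly λ f' → (a ≢ 0ℤ) × Deg< f' (suc d) × (f ≋ f' +ₚ Xp (suc d) *ₚ const a)) →
             EventuallyIntegral f J
  conclude (d , a , f' , a≢0 , deg-f' , f≋) =
    Conclusion.result f minimal α≢0 R complete J isJ d a f' a≢0 deg-f' f≋
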